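{- For any integer $s\ge 3$ and any $r\in\{1,2\}$, there is a constant $C$ such that in the $r$-offer $s$-uniform semirandom model there exists a strategy with the following property: for $n$ divisible by $s$, the hypergraph $H_t$ obtained after $t=Cn$ rounds asymptotically almost surely (with probability tending to $1$ as $n\to\infty$) contains a perfect matching.
   Context: The $r$-offer $s$-uniform semirandom model: a player builds a sequence of $s$-uniform hypergraphs $H_0, H_1, H_2, \ldots$ on vertex set $[n]=\{1,\ldots,n\}$, with $H_0$ empty. In each round $t\ge 1$, a uniformly random set of $r$ vertices of $[n]$ is offered; the player, knowing the offered vertices and the entire history (including $H_{t-1}$), chooses $s-r$ further vertices, and the resulting $s$-set is added as a hyperedge to $H_{t-1}$ to form $H_t$. (The player may also ignore an offer, which still counts as a round.) A strategy is a rule for these choices. A perfect matching in an $s$-uniform hypergraph on $[n]$ is a set of $n/s$ pairwise disjoint hyperedges covering $[n]$. -}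

module Defs where

open import Data.Nat using (ℕ; _∸_)
open import Data.Fin.Subset using (Subset; ⊥; ⊤; _∪_; _∩_; ∣_∣)
open import Data.List using (List; []; _∷_; _++_; [_]; foldr)
open import Data.List.Membership.Propositional using (_∈_)
open import Data.List.Relation.Unary.All using (All)
open import Data.List.Relation.Unary.AllPairs using (AllPairs)
open import Data.Maybe using (Maybe; just; nothing)
open import Data.Product using (Σ; _×_; _,_; proj₁)
open import Relation.Binary.PropositionalEquality using (_≡_)

Offer : ℕ → ℕ → Set
Offer n r = Σ (Subset n) λ S → ∣ S ∣ ≡ r

Disjoint : ∀ {n} → Subset n → Subset n → Set
Disjoint A B = A ∩ B ≡ ⊥

-- A legal answer to offer O in the s-uniform model: s - r further vertices,
-- disjoint from the offered ones (so that the union is an s-set).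
Response : ∀ {n r} → ℕ → Offer n r → Set
Response {n} {r} s O = Σ (Subset n) λ T → Disjoint (proj₁ O) T × ∣ T ∣ ≡ s ∸ r

-- A (deterministic) strategy: for each n, given the history of all previous
-- offers (chronological order; the player's own past choices are determined
-- by these) and the current offer, either ignore the offer (nothing) or
-- choose a legal response.
Strategy : ℕ → ℕ → Set
Strategy s r = (n : ℕ) → (history : List (Offer n r)) → (O : Offer n r)
             → Maybe (Response s O)

play : ∀ {s r} → Strategy s r → (n : ℕ) → List (Offer n r) → List (Offer n r)
     → List (Subset n)
play σ n history [] = []
play σ n history (O ∷ offers) with σ n history O
... | nothing = play σ n (history ++ [ O ]) offers
... | just (T , _) = (proj₁ O ∪ T) ∷ play σ n (history ++ [ O ]) offers

hypergraph : ∀ {s r} → Strategy s r → (n : ℕ) → List (Offer n r) → List (Subset n)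
hypergraph σ n offers = play σ n [] offers

HasPerfectMatching : ∀ {n} → List (Subset n) → Set
HasPerfectMatching {n} H =
  Σ (List (Subset n)) λ M → All (_∈ H) M × AllPairs Disjoint M × foldr _∪_ ⊥ M ≡ ⊤

module Submission where

-- Set aside p vertices X, each with its own block of s - 1 vertices, and let Y be the
-- remaining vertices; a hyperedge block x ∪ {y} is an edge xy of a bipartite graph.
--
-- First phase: linearly many random edges are exposed, and by a union bound every S ⊆ X
-- and T ⊆ Y with ∣S∣, ∣T∣ ≥ d (linear in n) are joined. Repeatedly deleting sets of size
-- at most d that do not expand leaves a core A ⊆ X, B ⊆ Y, with few vertices outside, in
-- which small sets on both sides expand; in particular A can be matched into B.
--
-- Second phase: the leftover vertices Z and the surplus of B over A have to be covered by
-- other hyperedges, each containing a random pair of B. A pair is accepted if its removal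
-- preserves Hall's condition for A into B. The sets on which Hall's condition is tight
-- form a lattice, so there is a largest tight set; all vertices outside its neighbourhood
-- are removable, and by expansion these are almost all of B as long as B is larger than
-- A. Hence every round succeeds with probability bounded below, until ∣A∣ = ∣B∣ and
-- Hall's theorem completes the matching.
--
-- In both phases the failure probability is bounded by an exponentially decaying
-- potential (number of unjoined pairs S, T, respectively 2^(missing successes) - 1).
-- With r = 1 the player simulates the second random vertex by the best choice.

open import Defs
open import Data.Nat hiding (∣_-_∣)
open import Data.Nat.Properties
open import Data.Nat.Combinatorics using (_C_; nC1≡n; nCk+nC[k+1]≡[n+1]C[k+1])
open import Data.Nat.Divisibility using (_∣_; divides; _∣?_)
open import Data.Nat.DivMod using (_/_; _%_; m≡m%n+[m/n]*n; m%n<n; m/n*n≤m; m≥n⇒m/n>0)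
open import Data.Nat.Tactic.RingSolver using (solve)
open import Data.Fin using (Fin; zero; suc)
import Data.Fin.Properties as Fin
open import Data.Fin.Properties using (any?; all?)
open import Data.Fin.Subset
open import Data.Fin.Subset.Properties
open import Data.Bool as Bool using (true; false)
open import Data.List using (List; []; _∷_; _++_; [_]; map; length; concat; cartesianProduct)
open import Data.List.Properties using (length-map; length-++; ++-assoc; ++-identityʳ)
open import Data.List.Membership.Propositional using () renaming (_∈_ to _∈ˡ_)
open import Data.List.Membership.Propositional.Properties
open import Data.List.Relation.Unary.Any as Any using (here; there)
open import Data.List.Relation.Unary.All as All using (All)
import Data.List.Relation.Unary.All.Properties as All
open import Data.List.Relation.Unary.AllPairs as AllPairs using (AllPairs)
import Data.List.Relation.Unary.AllPairs.Properties as AllPairs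
open import Data.List.Relation.Unary.Unique.Propositional using (Unique)
import Data.List.Relation.Unary.Unique.Propositional.Properties as Unique
open import Data.Maybe as Maybe using (Maybe; just; nothing)
open import Data.Vec as Vec using (Vec; here; there; toList)
import Data.Vec.Properties as Vec
open import Data.Product using (Σ; _×_; _,_; proj₁; proj₂; ∃; uncurry)
import Data.Product.Properties as Product
open import Data.Sum using (_⊎_; inj₁; inj₂; [_,_]′)
open import Data.Empty using (⊥-elim)
import Data.Empty as Empty
open import Function using (_∘_; flip)
open import Relation.Nullary using (¬_; Dec; yes; no)
open import Relation.Nullary.Decidable using (_×-dec_; _→-dec_; ¬?; map′)
open import Relation.Binary.PropositionalEquality using (_≡_; _≢_; refl; sym; trans; cong; cong₂; subst; module ≡-Reasoning)

private
  variable
    n r u L : ℕ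
    H       : List (Subset n)
    I J     : Set

-- Linear arithmetic: A ≤ B is a nonnegative combination of the hypotheses,
-- k the slack; the equation is left to the ring solver.
linear : ∀ {A B l r} k → A ≤ B → l + B + k ≡ r + A → l ≤ r
linear {A} {B} {l} {r} k A≤B eq = +-cancelʳ-≤ A l r (begin
  l + A       ≤⟨ +-monoʳ-≤ l A≤B ⟩
  l + B       ≤⟨ m≤m+n (l + B) k ⟩
  l + B + k   ≡⟨ eq ⟩
  r + A       ∎)
  where open ≤-Reasoning

scale : ∀ k {m n} → m ≤ n → k * m ≤ k * n
scale k = *-monoʳ-≤ k

-- Finite subsets and their cardinalities

Apart : Subset n → Subset n → Set
Apart p q = ∀ {x} → x ∈ p → x ∉ q

Apart-sym : {p q : Subset n} → Apart p q → Apart q p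
Apart-sym ap x∈q x∈p = ap x∈p x∈q

∣p∪q∣+∣p∩q∣≡∣p∣+∣q∣ : (p q : Subset n) → ∣ p ∪ q ∣ + ∣ p ∩ q ∣ ≡ ∣ p ∣ + ∣ q ∣
∣p∪q∣+∣p∩q∣≡∣p∣+∣q∣ Vec.[] Vec.[] = refl
∣p∪q∣+∣p∩q∣≡∣p∣+∣q∣ (false Vec.∷ p) (false Vec.∷ q) = ∣p∪q∣+∣p∩q∣≡∣p∣+∣q∣ p q
∣p∪q∣+∣p∩q∣≡∣p∣+∣q∣ (false Vec.∷ p) (true  Vec.∷ q) =
  trans (cong suc (∣p∪q∣+∣p∩q∣≡∣p∣+∣q∣ p q)) (sym (+-suc (∣ p ∣) (∣ q ∣)))
∣p∪q∣+∣p∩q∣≡∣p∣+∣q∣ (true  Vec.∷ p) (false Vec.∷ q) = cong suc (∣p∪q∣+∣p∩q∣≡∣p∣+∣q∣ p q)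
∣p∪q∣+∣p∩q∣≡∣p∣+∣q∣ (true  Vec.∷ p) (true  Vec.∷ q) = cong suc
  (trans (+-suc (∣ p ∪ q ∣) (∣ p ∩ q ∣))
    (trans (cong suc (∣p∪q∣+∣p∩q∣≡∣p∣+∣q∣ p q)) (sym (+-suc (∣ p ∣) (∣ q ∣)))))

Apart⇒∩≡⊥ : {p q : Subset n} → Apart p q → p ∩ q ≡ ⊥
Apart⇒∩≡⊥ {p = p} {q} ap = Empty-unique λ (x , x∈) →
  let (x∈p , x∈q) = x∈p∩q⁻ p q x∈ in ap x∈p x∈q

∣p∪q∣≡∣p∣+∣q∣ : {p q : Subset n} → Apart p q → ∣ p ∪ q ∣ ≡ ∣ p ∣ + ∣ q ∣
∣p∪q∣≡∣p∣+∣q∣ {n} {p} {q} ap = begin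
  ∣ p ∪ q ∣               ≡⟨ +-identityʳ _ ⟨
  ∣ p ∪ q ∣ + 0           ≡⟨ cong (∣ p ∪ q ∣ +_) (trans (cong ∣_∣ (Apart⇒∩≡⊥ ap)) (∣⊥∣≡0 n)) ⟨
  ∣ p ∪ q ∣ + ∣ p ∩ q ∣   ≡⟨ ∣p∪q∣+∣p∩q∣≡∣p∣+∣q∣ p q ⟩
  ∣ p ∣ + ∣ q ∣           ∎
  where open ≡-Reasoning

∣p∪q∣≤∣p∣+∣q∣ : (p q : Subset n) → ∣ p ∪ q ∣ ≤ ∣ p ∣ + ∣ q ∣
∣p∪q∣≤∣p∣+∣q∣ p q = ≤-trans (m≤m+n (∣ p ∪ q ∣) (∣ p ∩ q ∣)) (≤-reflexive (∣p∪q∣+∣p∩q∣≡∣p∣+∣q∣ p q))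

x∈p─q⇒x∉q : (p q : Subset n) → ∀ {x} → x ∈ p ─ q → x ∉ q
x∈p─q⇒x∉q (_ Vec.∷ p) (false Vec.∷ q) {suc x} (there x∈) (there x∈q) = x∈p─q⇒x∉q p q x∈ x∈q
x∈p─q⇒x∉q (_ Vec.∷ p) (true  Vec.∷ q) {suc x} (there x∈) (there x∈q) = x∈p─q⇒x∉q p q x∈ x∈q

∣p─q∣+∣q∣≡∣p∣ : {p q : Subset n} → q ⊆ p → ∣ p ─ q ∣ + ∣ q ∣ ≡ ∣ p ∣
∣p─q∣+∣q∣≡∣p∣ {p = p} {q} q⊆p = trans (sym (∣p∪q∣≡∣p∣+∣q∣ (x∈p─q⇒x∉q p q))) (cong ∣_∣ (⊆-antisym to from))
  where
  to : (p ─ q) ∪ q ⊆ p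
  to x∈ = [ p─q⊆p p q , q⊆p ]′ (x∈p∪q⁻ (p ─ q) q x∈)
  from : p ⊆ (p ─ q) ∪ q
  from {x} x∈p with x ∈? q
  ... | yes x∈q = x∈p∪q⁺ (inj₂ x∈q)
  ... | no  x∉q = x∈p∪q⁺ (inj₁ (x∈p∧x∉q⇒x∈p─q x∈p x∉q))

⁅x⁆⊆p : {p : Subset n} {x : Fin n} → x ∈ p → ⁅ x ⁆ ⊆ p
⁅x⁆⊆p {x = x} x∈p y∈ = subst (_∈ _) (sym (x∈⁅y⁆⇒x≡y x y∈)) x∈p

∣p-x∣+1≡∣p∣ : {p : Subset n} {x : Fin n} → x ∈ p → suc ∣ p - x ∣ ≡ ∣ p ∣
∣p-x∣+1≡∣p∣ {p = p} {x} x∈p = begin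
  suc ∣ p - x ∣           ≡⟨ +-comm 1 _ ⟩
  ∣ p - x ∣ + 1           ≡⟨ cong (∣ p - x ∣ +_) (∣⁅x⁆∣≡1 x) ⟨
  ∣ p - x ∣ + ∣ ⁅ x ⁆ ∣   ≡⟨ ∣p─q∣+∣q∣≡∣p∣ (⁅x⁆⊆p x∈p) ⟩
  ∣ p ∣                   ∎
  where open ≡-Reasoning

x∉p-x : (p : Subset n) (x : Fin n) → x ∉ p - x
x∉p-x p x x∈ = x∈p─q⇒x∉q p ⁅ x ⁆ x∈ (x∈⁅x⁆ x)

∣p∣>0⇒nonempty : (p : Subset n) → 0 < ∣ p ∣ → Nonempty p
∣p∣>0⇒nonempty {n} p 0<∣p∣ with nonempty? p
... | yes ne = ne
... | no ¬ne = ⊥-elim (<-irrefl (sym (trans (cong ∣_∣ (Empty-unique ¬ne)) (∣⊥∣≡0 n))) 0<∣p∣)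

subset-of-size : (p : Subset n) (k : ℕ) → k ≤ ∣ p ∣ → Σ (Subset n) λ q → q ⊆ p × ∣ q ∣ ≡ k
subset-of-size {n} p zero    _ = ⊥ , ⊥⊆ , ∣⊥∣≡0 n
subset-of-size {n} p (suc k) k<∣p∣ with subset-of-size p k (<⇒≤ k<∣p∣)
... | q , q⊆p , refl = q ∪ ⁅ x ⁆ , (λ y∈ → [ q⊆p , ⁅x⁆⊆p x∈p ]′ (x∈p∪q⁻ q ⁅ x ⁆ y∈)) , size
  where
  rest : Nonempty (p ─ q)
  rest = ∣p∣>0⇒nonempty (p ─ q) (+-cancelʳ-< (∣ q ∣) 0 (∣ p ─ q ∣)
           (subst (∣ q ∣ <_) (sym (∣p─q∣+∣q∣≡∣p∣ q⊆p)) k<∣p∣))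
  x = proj₁ rest
  x∈p = p─q⊆p p q (proj₂ rest)
  size : ∣ q ∪ ⁅ x ⁆ ∣ ≡ suc ∣ q ∣
  size = begin
    ∣ q ∪ ⁅ x ⁆ ∣       ≡⟨ ∣p∪q∣≡∣p∣+∣q∣ (λ y∈q y∈x → x∈p─q⇒x∉q p q (proj₂ rest) (subst (_∈ q)
      (x∈⁅y⁆⇒x≡y x y∈x) y∈q)) ⟩
    ∣ q ∣ + ∣ ⁅ x ⁆ ∣   ≡⟨ cong (∣ q ∣ +_) (∣⁅x⁆∣≡1 x) ⟩
    ∣ q ∣ + 1           ≡⟨ +-comm (∣ q ∣) 1 ⟩
    suc ∣ q ∣           ∎
    where open ≡-Reasoning

-- Hall's theorem and expanding cores

EdgeRel : ℕ → Set₁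
EdgeRel n = Fin n → Fin n → Set

Indep : EdgeRel n → Subset n → Subset n → Set
Indep E S T = ∀ {x y} → x ∈ S → y ∈ T → ¬ E x y

-- Hall's condition for matching A into B, with the neighbourhood of S replaced
-- by the complement of an independent T.
Hall : EdgeRel n → Subset n → Subset n → Set
Hall E A B = ∀ {S T} → S ⊆ A → T ⊆ B → Indep E S T → ∣ S ∣ + ∣ T ∣ ≤ ∣ B ∣

Joined : EdgeRel n → ℕ → Subset n → Subset n → Set
Joined E d X Y = ∀ {S T} → S ⊆ X → T ⊆ Y → d ≤ ∣ S ∣ → d ≤ ∣ T ∣ → ¬ Indep E S T

-- With `T` the set of non-neighbours of `S` in `B`, this is the usual expansion by a factor of two:
-- a set of at most `d` vertices has at least twice as many neighbours.
Expands : EdgeRel n → ℕ → Subset n → Subset n → Set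
Expands E d A B = ∀ {S T} → S ⊆ A → T ⊆ B → Indep E S T → ∣ S ∣ ≤ d → 2 * ∣ S ∣ + ∣ T ∣ ≤ ∣ B ∣

data Matching (E : EdgeRel n) : Subset n → Subset n → Set where
  done : ∀ {A B} → ∣ A ∣ ≡ 0 → Matching E A B
  pair : ∀ {A B x y} → x ∈ A → y ∈ B → E x y → Matching E (A - x) (B - y) → Matching E A B

Joined-flip : {E : EdgeRel n} {d : ℕ} {X Y : Subset n} → Joined E d X Y → Joined (flip E) d Y X
Joined-flip joined T⊆Y S⊆X d≤T d≤S ind = joined S⊆X T⊆Y d≤S d≤T (λ x∈ y∈ → ind y∈ x∈)

∪-⊆ : {p q r : Subset n} → p ⊆ r → q ⊆ r → p ∪ q ⊆ r
∪-⊆ {p = p} {q} p⊆r q⊆r x∈ = [ p⊆r , q⊆r ]′ (x∈p∪q⁻ p q x∈)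

∩-⊆ˡ : {p r : Subset n} (q : Subset n) → p ⊆ r → p ∩ q ⊆ r
∩-⊆ˡ {p = p} q p⊆r x∈ = p⊆r (p∩q⊆p p q x∈)

Indep-∪-∩ : {E : EdgeRel n} {S S′ T T′ : Subset n} →
            Indep E S T → Indep E S′ T′ → Indep E (S ∪ S′) (T ∩ T′)
Indep-∪-∩ {S = S} {S′} {T} {T′} ind ind′ x∈ y∈ with x∈p∪q⁻ S S′ x∈
... | inj₁ x∈S  = ind  x∈S  (p∩q⊆p T T′ y∈)
... | inj₂ x∈S′ = ind′ x∈S′ (p∩q⊆q T T′ y∈)

Indep-∩-∪ : {E : EdgeRel n} {S S′ T T′ : Subset n} →
            Indep E S T → Indep E S′ T′ → Indep E (S ∩ S′) (T ∪ T′)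
Indep-∩-∪ {S = S} {S′} {T} {T′} ind ind′ x∈ y∈ with x∈p∪q⁻ T T′ y∈
... | inj₁ y∈T  = ind  (p∩q⊆p S S′ x∈) y∈T
... | inj₂ y∈T′ = ind′ (p∩q⊆q S S′ x∈) y∈T′

indep? : {E : EdgeRel n} → (∀ x y → Dec (E x y)) → ∀ S T → Dec (Indep E S T)
indep? E? S T = map′ (λ f x∈ y∈ → f _ x∈ _ y∈) (λ f _ x∈ _ y∈ → f x∈ y∈)
  (all? λ x → (x ∈? S) →-dec all? λ y → (y ∈? T) →-dec ¬? (E? x y))

module _ {n} {E : EdgeRel n} (E? : ∀ x y → Dec (E x y)) where

  private
    Tight : Subset n → Subset n → Subset n → Subset n → Set
    Tight A B S T = S ⊆ A × T ⊆ B × Indep E S T × ∣ S ∣ + ∣ T ∣ ≡ ∣ B ∣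

    tight? : ∀ A B S T → Dec (Tight A B S T)
    tight? A B S T = (S ⊆? A) ×-dec (T ⊆? B) ×-dec indep? E? S T ×-dec (_ ≟ _)

    Blocking : Subset n → Subset n → Fin n → Set
    Blocking A B y = Σ (Subset n) λ S → Σ (Subset n) λ T → Tight A B S T × y ∉ T

    blocking? : ∀ A B y → Dec (Blocking A B y)
    blocking? A B y = anySubset? λ S → anySubset? λ T → tight? A B S T ×-dec ¬? (y ∈? T)

    -- An independent pair within `B - y` is also one within `B`, so Hall's condition can only be
    -- off by one, and then the pair is tight for `B` with `y` outside `T`.
    ¬blocking⇒hall : ∀ {A B y} → y ∈ B → Hall E A B → ¬ Blocking A B y → Hall E A (B - y)
    ¬blocking⇒hall {A} {B} {y} y∈B hall ¬bl {S} {T} S⊆A T⊆B-y ind =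
      s≤s⁻¹ (subst (suc (∣ S ∣ + ∣ T ∣) ≤_) (sym (∣p-x∣+1≡∣p∣ y∈B))
        (≤∧≢⇒< (hall S⊆A T⊆B ind) λ eq → ¬bl (S , T , (S⊆A , (λ {x} → T⊆B {x}) , ind , eq) , λ y∈T →
          x∉p-x B y (T⊆B-y y∈T))))
      where
      T⊆B : T ⊆ B
      T⊆B x∈ = p─q⊆p B ⁅ y ⁆ (T⊆B-y x∈)

    -- Submodularity: `(S ∪ S′ , T ∩ T′)` and `(S ∩ S′ , T ∪ T′)` are both independent, so each has
    -- size at most `∣ B ∣`. Together they have size `2 * ∣ B ∣`, which forces equality.
    combine : ∀ {A B S T S′ T′} → Hall E A B → Tight A B S T → Tight A B S′ T′ →
              Tight A B (S ∪ S′) (T ∩ T′)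
    combine {A} {B} {S} {T} {S′} {T′} hall (S⊆A , T⊆B , ind , eq) (S′⊆A , T′⊆B , ind′ , eq′) =
      ∪-⊆ S⊆A S′⊆A , ∩-⊆ˡ T′ T⊆B , Indep-∪-∩ ind ind′ ,
      ≤-antisym (hall (∪-⊆ S⊆A S′⊆A) (∩-⊆ˡ T′ T⊆B) (Indep-∪-∩ ind ind′))
        (submodular (∣ S ∣) (∣ T ∣) (∣ S′ ∣) (∣ T′ ∣) (∣ S ∪ S′ ∣) (∣ S ∩ S′ ∣) (∣ T ∪ T′ ∣) (∣ T ∩ T′ ∣)
          (∣ B ∣)
          (≤-reflexive (sym eq)) (≤-reflexive (sym eq′))
          (≤-reflexive (sym (∣p∪q∣+∣p∩q∣≡∣p∣+∣q∣ S S′))) (≤-reflexive (sym (∣p∪q∣+∣p∩q∣≡∣p∣+∣q∣ T T′)))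
          (hall (∩-⊆ˡ S′ S⊆A) (∪-⊆ T⊆B T′⊆B) (Indep-∩-∪ ind ind′)))
      where
      submodular : ∀ s t s′ t′ u i u′ i′ b → b ≤ s + t → b ≤ s′ + t′ → s + s′ ≤ u + i →
                   t + t′ ≤ u′ + i′ → i + u′ ≤ b → b ≤ u + i′
      submodular s t s′ t′ u i u′ i′ b p q r v w =
        linear 0 (+-mono-≤ p (+-mono-≤ q (+-mono-≤ r (+-mono-≤ v w))))
          (solve (s ∷ t ∷ s′ ∷ t′ ∷ u ∷ i ∷ u′ ∷ i′ ∷ b ∷ []))

    -- Whenever some `y ∈ T` is blocked by a tight pair avoiding it, combining with that pair drops
    -- `y` from `T`. The bound `k` on `∣ T ∣` makes this stop, and then every vertex of `T` is
    -- removable.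
    shrink : ∀ {A B} → Hall E A B → ∀ k S T → ∣ T ∣ ≤ k → Tight A B S T →
             Σ (Subset n) λ S → Σ (Subset n) λ T → Tight A B S T × (∀ {y} → y ∈ T → Hall E A (B - y))
    shrink {A} {B} hall k S T T≤k tight with any? (λ y → (y ∈? T) ×-dec blocking? A B y)
    ... | no ¬bl = S , T , tight , λ {y} y∈T → ¬blocking⇒hall (proj₁ (proj₂ tight) y∈T) hall λ bl → ¬bl (y ,
      y∈T , bl)
    shrink hall zero S T T≤k tight | yes (y , y∈T , _) = ⊥-elim (n≮0 (≤-trans (x∈p⇒∣p-x∣<∣p∣ y∈T) T≤k))
    shrink hall (suc k) S T T≤k tight | yes (y , y∈T , S′ , T′ , tight′ , y∉T′) =
      shrink hall k (S ∪ S′) (T ∩ T′)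
        (s≤s⁻¹ (≤-trans (p⊂q⇒∣p∣<∣q∣ (p∩q⊆p T T′ , y , y∈T , λ y∈ → y∉T′ (p∩q⊆q T T′ y∈))) T≤k))
        (combine hall tight tight′)

  -- The critical pairs of Hall's condition form a lattice; a vertex in the
  -- smallest T can be deleted from B without violating the condition.
  removable : ∀ {A B} → Hall E A B → Σ (Subset n) λ S → Σ (Subset n) λ T →
              (S ⊆ A × T ⊆ B × Indep E S T × ∣ S ∣ + ∣ T ∣ ≡ ∣ B ∣) × (∀ {y} → y ∈ T → Hall E A (B - y))
  removable {A} {B} hall = shrink hall (∣ B ∣) ⊥ B ≤-refl
    (⊥⊆ , (λ x∈ → x∈) , (λ x∈⊥ → ⊥-elim (∉⊥ x∈⊥)) , cong (_+ ∣ B ∣) (∣⊥∣≡0 n))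

  -- Induction on `∣ A ∣`. Any `x ∈ A` is set aside and the removable set `T` is taken with respect
  -- to `A - x`. A neighbour of `x` in `T` can be matched to `x` without losing Hall's condition for
  -- the rest.
  hall⇒matching : ∀ k {A B} → ∣ A ∣ ≡ k → Hall E A B → Matching E A B
  hall⇒matching zero A≡0 hall = done A≡0
  hall⇒matching (suc k) {A} {B} A≡k hall = go (any? λ y → (y ∈? T) ×-dec E? x y)
    where
    nonemptyA : Nonempty A
    nonemptyA = ∣p∣>0⇒nonempty A (subst (0 <_) (sym A≡k) z<s)
    x = proj₁ nonemptyA
    x∈A = proj₂ nonemptyA
    A-x⊆A : A - x ⊆ A
    A-x⊆A = p─q⊆p A ⁅ x ⁆
    crit = removable {A - x} {B} (λ S⊆ T⊆ → hall (λ z∈ → A-x⊆A (S⊆ z∈)) T⊆)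
    S = proj₁ crit
    T = proj₁ (proj₂ crit)
    S⊆A-x : S ⊆ A - x
    S⊆A-x = proj₁ (proj₁ (proj₂ (proj₂ crit)))
    T⊆B : T ⊆ B
    T⊆B = proj₁ (proj₂ (proj₁ (proj₂ (proj₂ crit))))
    ind = proj₁ (proj₂ (proj₂ (proj₁ (proj₂ (proj₂ crit)))))
    eq = proj₂ (proj₂ (proj₂ (proj₁ (proj₂ (proj₂ crit)))))
    size : ∣ S ∪ ⁅ x ⁆ ∣ + ∣ T ∣ ≡ suc (∣ B ∣)
    size = trans (cong (_+ ∣ T ∣) (trans (∣p∪q∣≡∣p∣+∣q∣ S⊥x) (trans (cong (∣ S ∣ +_) (∣⁅x⁆∣≡1 x)) (+-comm
      (∣ S ∣) 1)))) (cong suc eq)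
      where
      S⊥x : Apart S ⁅ x ⁆
      S⊥x z∈S z∈x = x∉p-x A x (subst (_∈ A - x) (x∈⁅y⁆⇒x≡y x z∈x) (S⊆A-x z∈S))
    go : Dec (∃ λ y → y ∈ T × E x y) → Matching E A B
    go (yes (y , y∈T , xy)) = pair x∈A (T⊆B y∈T) xy
      (hall⇒matching k (suc-injective (trans (∣p-x∣+1≡∣p∣ x∈A) A≡k)) (proj₂ (proj₂ (proj₂ crit)) y∈T))
    -- Without a neighbour in `T`, adding `x` to `S` keeps the pair independent and raises its size
    -- to `∣ B ∣ + 1`, against Hall's condition for `A`.
    go (no ¬nbr) = ⊥-elim (<-irrefl refl (subst (_≤ ∣ B ∣) size
      (hall (∪-⊆ (λ z∈ → A-x⊆A (S⊆A-x z∈)) (⁅x⁆⊆p x∈A)) T⊆B ind′)))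
      where
      ind′ : Indep E (S ∪ ⁅ x ⁆) T
      ind′ z∈ y∈ zy with x∈p∪q⁻ S ⁅ x ⁆ z∈
      ... | inj₁ z∈S = ind z∈S y∈ zy
      ... | inj₂ z∈x = ¬nbr (_ , y∈ , subst (λ z → E z _) (x∈⁅y⁆⇒x≡y x z∈x) zy)

-- Pruning to an expanding core

x∈p─q⁻ : (p q : Subset n) → ∀ {x} → x ∈ p ─ q → x ∈ p × x ∉ q
x∈p─q⁻ p q x∈ = p─q⊆p p q x∈ , x∈p─q⇒x∉q p q x∈

∣p∣≤∣p─q∣+∣q∣ : (p q : Subset n) → ∣ p ∣ ≤ ∣ p ─ q ∣ + ∣ q ∣
∣p∣≤∣p─q∣+∣q∣ p q = ≤-trans (p⊆q⇒∣p∣≤∣q∣ sub) (∣p∪q∣≤∣p∣+∣q∣ (p ─ q) q)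
  where
  sub : p ⊆ (p ─ q) ∪ q
  sub {x} x∈p with x ∈? q
  ... | yes x∈q = x∈p∪q⁺ (inj₂ x∈q)
  ... | no  x∉q = x∈p∪q⁺ (inj₁ (x∈p∧x∉q⇒x∈p─q x∈p x∉q))

-- A arises from X by deleting a set which does not expand into B.
record Pruned (E : EdgeRel n) (d : ℕ) (X A B : Subset n) : Set where
  field
    A⊆X   : A ⊆ X
    few   : ∣ X ─ A ∣ ≤ d
    far   : Subset n
    far⊆B : far ⊆ B
    indep : Indep E (X ─ A) far
    large : ∣ B ∣ ≤ 2 * ∣ X ─ A ∣ + ∣ far ∣

-- Failures of expansion accumulate: the union of the deleted sets is independent of the
-- intersection of the witnesses and still fails to expand. It has at most `2 * d` elements, so if
-- it had more than `d`, joinedness would leave fewer than `d` far vertices. Then `Y` would have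
-- fewer than `d + 4 * d + d` vertices.
prune-self : ∀ {E : EdgeRel n} {d X Y A B S T} → Joined E d X Y → 6 * d ≤ ∣ Y ∣ →
             B ⊆ Y → ∣ Y ─ B ∣ ≤ d → Pruned E d X A B →
             S ⊆ A → T ⊆ B → Indep E S T → ∣ S ∣ ≤ d → ∣ B ∣ < 2 * ∣ S ∣ + ∣ T ∣ →
             Pruned E d X (A ─ S) B
prune-self {n} {E} {d} {X} {Y} {A} {B} {S} {T} joined 6d≤Y B⊆Y Y─B≤d pr S⊆A T⊆B ind S≤d viol = record
  { A⊆X   = A′⊆X
  ; few   = ≮⇒≥ ¬many
  ; far   = far ∩ T
  ; far⊆B = ∩-⊆ˡ T far⊆B
  ; indep = ind′
  ; large = large′
  }
  where
  open Pruned pr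
  A′⊆X : A ─ S ⊆ X
  A′⊆X x∈ = A⊆X (p─q⊆p A S x∈)
  ind′ : Indep E (X ─ (A ─ S)) (far ∩ T)
  ind′ {x} x∈ y∈ with x ∈? A
  ... | no  x∉A = indep (x∈p∧x∉q⇒x∈p─q (p─q⊆p X (A ─ S) x∈) x∉A) (p∩q⊆p far T y∈)
  ... | yes x∈A with x ∈? S
  ...   | yes x∈S = ind x∈S (p∩q⊆q far T y∈)
  ...   | no  x∉S = ⊥-elim (x∈p─q⇒x∉q X (A ─ S) x∈ (x∈p∧x∉q⇒x∈p─q x∈A x∉S))
  grow : ∣ X ─ (A ─ S) ∣ ≡ ∣ X ─ A ∣ + ∣ S ∣
  grow = +-cancelʳ-≡ (∣ A ─ S ∣) _ _ (begin
    ∣ X ─ (A ─ S) ∣ + ∣ A ─ S ∣        ≡⟨ ∣p─q∣+∣q∣≡∣p∣ A′⊆X ⟩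
    ∣ X ∣                              ≡⟨ ∣p─q∣+∣q∣≡∣p∣ A⊆X ⟨
    ∣ X ─ A ∣ + ∣ A ∣                  ≡⟨ cong (∣ X ─ A ∣ +_) (trans (+-comm (∣ S ∣) _)
      (∣p─q∣+∣q∣≡∣p∣ S⊆A)) ⟨
    ∣ X ─ A ∣ + (∣ S ∣ + ∣ A ─ S ∣)    ≡⟨ +-assoc (∣ X ─ A ∣) (∣ S ∣) (∣ A ─ S ∣) ⟨
    ∣ X ─ A ∣ + ∣ S ∣ + ∣ A ─ S ∣      ∎)
    where open ≡-Reasoning
  arith : ∀ a σ b u i ν τ → b ≤ 2 * a + ν → suc b ≤ 2 * σ + τ → ν + τ ≤ u + i → u ≤ b → b ≤ 2 * (a + σ) + i
  arith a σ b u i ν τ p q r w = linear 1 (+-mono-≤ p (+-mono-≤ q (+-mono-≤ r w)))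
    (solve (a ∷ σ ∷ b ∷ u ∷ i ∷ ν ∷ τ ∷ []))
  large′ : ∣ B ∣ ≤ 2 * ∣ X ─ (A ─ S) ∣ + ∣ far ∩ T ∣
  large′ = subst (λ a → ∣ B ∣ ≤ 2 * a + ∣ far ∩ T ∣) (sym grow)
    (arith (∣ X ─ A ∣) (∣ S ∣) (∣ B ∣) (∣ far ∪ T ∣) (∣ far ∩ T ∣) (∣ far ∣) (∣ T ∣) large viol
      (≤-reflexive (sym (∣p∪q∣+∣p∩q∣≡∣p∣+∣q∣ far T))) (p⊆q⇒∣p∣≤∣q∣ (∪-⊆ far⊆B T⊆B)))
  arith₂ : ∀ a σ b i c y → b ≤ 2 * (a + σ) + i → a ≤ d → σ ≤ d → c ≤ d → suc i ≤ d → y ≤ c + b →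
    suc y ≤ 6 * d
  arith₂ a σ b i c y p q r t v w = linear 0
    (+-mono-≤ p (+-mono-≤ (scale 2 q) (+-mono-≤ (scale 2 r) (+-mono-≤ t (+-mono-≤ v w)))))
    (solve (a ∷ σ ∷ b ∷ i ∷ c ∷ y ∷ d ∷ []))
  ¬many : ¬ d < ∣ X ─ (A ─ S) ∣
  ¬many d<X─A′ = <⇒≱ (arith₂ (∣ X ─ A ∣) (∣ S ∣) (∣ B ∣) (∣ far ∩ T ∣) (∣ Y ─ B ∣) (∣ Y ∣)
    (subst (λ a → ∣ B ∣ ≤ 2 * a + ∣ far ∩ T ∣) grow large′) few S≤d Y─B≤d
    (≰⇒> λ d≤far → joined (p─q⊆p X (A ─ S)) (λ y∈ → B⊆Y (∩-⊆ˡ T far⊆B y∈)) (<⇒≤ d<X─A′) d≤far ind′)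
    (≤-reflexive (sym (∣p─q∣+∣q∣≡∣p∣ B⊆Y)))) 6d≤Y

-- Deleting `S` lowers `∣ B ∣` by `∣ S ∣` and `∣ far ∣` by no more than that, so `large` survives.
prune-other : ∀ {E : EdgeRel n} {d X A B S} → Pruned E d X A B → S ⊆ B → Pruned E d X A (B ─ S)
prune-other {X = X} {A} {B} {S} pr S⊆B = record
  { A⊆X   = A⊆X
  ; few   = few
  ; far   = far ─ S
  ; far⊆B = λ x∈ → let (x∈far , x∉S) = x∈p─q⁻ far S x∈ in x∈p∧x∉q⇒x∈p─q (far⊆B x∈far) x∉S
  ; indep = λ x∈ y∈ → indep x∈ (p─q⊆p far S y∈)
  ; large = arith (∣ B ─ S ∣) (∣ S ∣) (∣ B ∣) (∣ X ─ A ∣) (∣ far ∣) (∣ far ─ S ∣)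
              (≤-reflexive (∣p─q∣+∣q∣≡∣p∣ S⊆B)) large (∣p∣≤∣p─q∣+∣q∣ far S)
  }
  where
  open Pruned pr
  arith : ∀ b′ σ b a ν ν′ → b′ + σ ≤ b → b ≤ 2 * a + ν → ν ≤ ν′ + σ → b′ ≤ 2 * a + ν′
  arith b′ σ b a ν ν′ p q r = linear 0 (+-mono-≤ p (+-mono-≤ q r)) (solve (b′ ∷ σ ∷ b ∷ a ∷ ν ∷ ν′ ∷ []))

record Core (E : EdgeRel n) (d : ℕ) (X Y : Subset n) : Set where
  field
    A B      : Subset n
    A⊆X      : A ⊆ X
    B⊆Y      : B ⊆ Y
    X─A≤d    : ∣ X ─ A ∣ ≤ d
    Y─B≤d    : ∣ Y ─ B ∣ ≤ d
    expands  : Expands E d A B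
    expands′ : Expands (flip E) d B A

module _ {n} {E : EdgeRel n} (E? : ∀ x y → Dec (E x y)) {d : ℕ} {X Y : Subset n}
         (joined : Joined E d X Y) (6d≤X : 6 * d ≤ ∣ X ∣) (6d≤Y : 6 * d ≤ ∣ Y ∣) where

  private
    Violation : EdgeRel n → Subset n → Subset n → Subset n → Subset n → Set
    Violation F A B S T = S ⊆ A × T ⊆ B × Indep F S T × ∣ S ∣ ≤ d × ∣ B ∣ < 2 * ∣ S ∣ + ∣ T ∣

    violation? : {F : EdgeRel n} → (∀ x y → Dec (F x y)) → ∀ A B →
                 Dec (Σ (Subset n) λ S → Σ (Subset n) λ T → Violation F A B S T)
    violation? F? A B = anySubset? λ S → anySubset? λ T →
      (S ⊆? A) ×-dec (T ⊆? B) ×-dec indep? F? S T ×-dec (_ ≤? _) ×-dec (_ <? _)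

    no-violation : {F : EdgeRel n} → ∀ {A B} → ¬ (Σ (Subset n) λ S → Σ (Subset n) λ T →
      Violation F A B S T) →
                   Expands F d A B
    no-violation ¬v {S} {T} S⊆A T⊆B ind S≤d = ≮⇒≥ λ lt → ¬v (S , T , (λ {x} → S⊆A {x}) , (λ {x} → T⊆B {x}) ,
      ind , S≤d , lt)

    nonempty-violation : (A B S T : Subset n) → S ⊆ A → T ⊆ B → ∣ B ∣ < 2 * ∣ S ∣ + ∣ T ∣ →
      ∣ A ─ S ∣ < ∣ A ∣
    nonempty-violation A B S T S⊆A T⊆B lt with ∣ S ∣ in eq
    ... | zero  = ⊥-elim (<⇒≱ lt (p⊆q⇒∣p∣≤∣q∣ T⊆B))
    ... | suc σ = subst (∣ A ─ S ∣ <_) (trans (cong (∣ A ─ S ∣ +_) (sym eq)) (∣p─q∣+∣q∣≡∣p∣ S⊆A)) (m<m+n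
      (∣ A ─ S ∣) z<s)

    -- Each violation has a nonempty `S`, so deleting it lowers `∣ A ∣ + ∣ B ∣`, which `k` bounds. A
    -- deletion on either side keeps both invariants, by `prune-self` for that side and
    -- `prune-other` for the opposite one.
    prune : ∀ k {A B} → ∣ A ∣ + ∣ B ∣ ≤ k → Pruned E d X A B → Pruned (flip E) d Y B A → Core E d X Y
    prune k {A} {B} ≤k prA prB with violation? E? A B | violation? (flip E?) B A
    ... | no ¬v | no ¬v′ = record
      { A = A ; B = B ; A⊆X = Pruned.A⊆X prA ; B⊆Y = Pruned.A⊆X prB
      ; X─A≤d = Pruned.few prA ; Y─B≤d = Pruned.few prB
      ; expands = no-violation ¬v ; expands′ = no-violation ¬v′ }
    prune zero {A} {B} ≤k prA prB | yes (S , T , S⊆A , T⊆B , _ , _ , lt) | _ =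
      ⊥-elim (n≮0 (<-≤-trans (nonempty-violation A B S T S⊆A T⊆B lt) (m+n≤o⇒m≤o (∣ A ∣) ≤k)))
    prune (suc k) {A} {B} ≤k prA prB | yes (S , T , S⊆A , T⊆B , ind , S≤d , lt) | _ =
      prune k (s≤s⁻¹ (≤-trans (+-monoˡ-< (∣ B ∣) (nonempty-violation A B S T S⊆A T⊆B lt)) ≤k))
        (prune-self joined 6d≤Y (Pruned.A⊆X prB) (Pruned.few prB) prA S⊆A T⊆B ind S≤d lt)
        (prune-other prB S⊆A)
    prune zero {A} {B} ≤k prA prB | no _ | yes (T , S , T⊆B , S⊆A , _ , _ , lt) =
      ⊥-elim (n≮0 (<-≤-trans (nonempty-violation B A T S T⊆B S⊆A lt) (m+n≤o⇒n≤o (∣ A ∣) ≤k)))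
    prune (suc k) {A} {B} ≤k prA prB | no _ | yes (T , S , T⊆B , S⊆A , ind , T≤d , lt) =
      prune k (s≤s⁻¹ (≤-trans (+-monoʳ-< (∣ A ∣) (nonempty-violation B A T S T⊆B S⊆A lt)) ≤k))
        (prune-other prA T⊆B)
        (prune-self (Joined-flip joined) 6d≤X (Pruned.A⊆X prA) (Pruned.few prA) prB T⊆B S⊆A ind T≤d lt)

    unpruned : {F : EdgeRel n} (X B : Subset n) → Pruned F d X X B
    unpruned X B = record
      { A⊆X = λ x∈ → x∈ ; few = subst (_≤ d) (sym X─X) z≤n ; far = B ; far⊆B = λ x∈ → x∈
      ; indep = λ x∈ → ⊥-elim (x∈p─q⇒x∉q X X x∈ (p─q⊆p X X x∈)) ; large = m≤n+m (∣ B ∣) _ }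
      where
      X─X : ∣ X ─ X ∣ ≡ 0
      X─X = +-cancelʳ-≡ (∣ X ∣) _ 0 (∣p─q∣+∣q∣≡∣p∣ {p = X} (λ x∈ → x∈))

  core : Core E d X Y
  core = prune (∣ X ∣ + ∣ Y ∣) ≤-refl (unpruned X Y) (unpruned Y X)

  module _ (C : Core E d X Y) where
    open Core C

    -- A small `S` expands into `B`. If `S` is large, joinedness makes `T` small, and the expansion
    -- of `T` into `A` gives `∣ S ∣ + ∣ T ∣ ≤ ∣ A ∣`.
    core-hall : ∣ A ∣ ≤ ∣ B ∣ → Hall E A B
    core-hall A≤B {S} {T} S⊆A T⊆B ind with ∣ S ∣ ≤? d
    ... | yes S≤d = ≤-trans (+-monoˡ-≤ (∣ T ∣) (m≤n*m (∣ S ∣) 2)) (expands S⊆A T⊆B ind S≤d)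
    ... | no  S≰d = ≤-trans (≤-reflexive (+-comm (∣ S ∣) (∣ T ∣)))
      (≤-trans (+-monoˡ-≤ (∣ S ∣) (m≤n*m (∣ T ∣) 2))
      (≤-trans (expands′ T⊆B S⊆A (λ y∈ x∈ → ind x∈ y∈) T≤d) A≤B))
      where
      T≤d : ∣ T ∣ ≤ d
      T≤d = <⇒≤ (≰⇒> λ d≤T → joined (λ x∈ → A⊆X (S⊆A x∈)) (λ y∈ → B⊆Y (T⊆B y∈)) (<⇒≤ (≰⇒> S≰d)) d≤T ind)

    -- The size bound says that at most ∣B∣ ∸ ∣B′∣ vertices of B′ are not in T.
    core-removable : ∀ {B′} → B′ ⊆ B → ∣ A ∣ < ∣ B′ ∣ → Hall E A B′ →
      Σ (Subset n) λ T → T ⊆ B′ × 2 * ∣ B′ ∣ ≤ ∣ T ∣ + ∣ B ∣ × (∀ {y} → y ∈ T → Hall E A (B′ - y))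
    core-removable {B′} B′⊆B A<B′ hall with removable E? hall
    ... | S , T , (S⊆A , T⊆B′ , ind , eq) , rem with ∣ S ∣ ≤? d
    ...   | yes S≤d = T , (λ {x} → T⊆B′ {x}) , arith (∣ S ∣) (∣ T ∣) (∣ B′ ∣) (∣ B ∣) (≤-reflexive (sym eq))
                        (expands S⊆A (λ x∈ → B′⊆B (T⊆B′ x∈)) ind S≤d) , rem
      where
      arith : ∀ s t b′ b → b′ ≤ s + t → 2 * s + t ≤ b → 2 * b′ ≤ t + b
      arith s t b′ b p q = linear 0 (+-mono-≤ (scale 2 p) q) (solve (s ∷ t ∷ b′ ∷ b ∷ []))
    -- A large `S` forces a small `T`, whose expansion bounds `∣ S ∣ + ∣ T ∣` by `∣ A ∣ < ∣ B′ ∣`.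
    -- The pair would not be tight.
    ...   | no  S≰d = ⊥-elim (<⇒≱ A<B′ (≤-trans (≤-reflexive (sym eq)) (≤-trans (≤-reflexive (+-comm (∣ S ∣)
      (∣ T ∣)))
      (≤-trans (+-monoˡ-≤ (∣ S ∣) (m≤n*m (∣ T ∣) 2))
        (expands′ (λ x∈ → B′⊆B (T⊆B′ x∈)) S⊆A (λ y∈ x∈ → ind x∈ y∈) T≤d)))))
      where
      T≤d : ∣ T ∣ ≤ d
      T≤d = <⇒≤ (≰⇒> λ d≤T → joined (λ x∈ → A⊆X (S⊆A x∈)) (λ y∈ → B⊆Y (B′⊆B (T⊆B′ y∈))) (<⇒≤
        (≰⇒> S≰d)) d≤T ind)

-- Sums, offers and sampling

∑ : List I → (I → ℕ) → ℕ
∑ []       f = 0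
∑ (x ∷ xs) f = f x + ∑ xs f

∑-mono : (xs : List I) {f g : I → ℕ} → (∀ x → f x ≤ g x) → ∑ xs f ≤ ∑ xs g
∑-mono []       f≤g = z≤n
∑-mono (x ∷ xs) f≤g = +-mono-≤ (f≤g x) (∑-mono xs f≤g)

∑-cong : (xs : List I) {f g : I → ℕ} → (∀ x → f x ≡ g x) → ∑ xs f ≡ ∑ xs g
∑-cong xs f≡g = ≤-antisym (∑-mono xs (λ x → ≤-reflexive (f≡g x))) (∑-mono xs (λ x → ≤-reflexive (sym
  (f≡g x))))

∑-+ : (xs : List I) (f g : I → ℕ) → ∑ xs (λ x → f x + g x) ≡ ∑ xs f + ∑ xs g
∑-+ []       f g = refl
∑-+ (x ∷ xs) f g rewrite ∑-+ xs f g = rearrange (f x) (g x) (∑ xs f) (∑ xs g)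
  where
  rearrange : ∀ a b c d → a + b + (c + d) ≡ a + c + (b + d)
  rearrange a b c d = solve (a ∷ b ∷ c ∷ d ∷ [])

∑-* : ∀ k (xs : List I) (f : I → ℕ) → ∑ xs (λ x → k * f x) ≡ k * ∑ xs f
∑-* k []       f = sym (*-zeroʳ k)
∑-* k (x ∷ xs) f rewrite ∑-* k xs f = sym (*-distribˡ-+ k (f x) (∑ xs f))

∑-const : ∀ k (xs : List I) → ∑ xs (λ _ → k) ≡ length xs * k
∑-const k []       = refl
∑-const k (x ∷ xs) = cong (k +_) (∑-const k xs)

∑-swap : (xs : List I) (ys : List J) (f : I → J → ℕ) →
         ∑ xs (λ x → ∑ ys (f x)) ≡ ∑ ys (λ y → ∑ xs (λ x → f x y))
∑-swap []       ys f = sym (trans (∑-const 0 ys) (*-zeroʳ (length ys)))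
∑-swap (x ∷ xs) ys f rewrite ∑-swap xs ys f = sym (∑-+ ys (f x) (λ y → ∑ xs (λ x → f x y)))

∑-++ : (xs ys : List I) (f : I → ℕ) → ∑ (xs ++ ys) f ≡ ∑ xs f + ∑ ys f
∑-++ []       ys f = refl
∑-++ (x ∷ xs) ys f rewrite ∑-++ xs ys f = sym (+-assoc (f x) (∑ xs f) (∑ ys f))

∑-map : (h : I → J) (xs : List I) (f : J → ℕ) → ∑ (map h xs) f ≡ ∑ xs (λ x → f (h x))
∑-map h []       f = refl
∑-map h (x ∷ xs) f = cong (f (h x) +_) (∑-map h xs f)

∑-cartesianProduct : (xs : List I) (ys : List J) (f : I × J → ℕ) →
                     ∑ (cartesianProduct xs ys) f ≡ ∑ xs (λ x → ∑ ys (λ y → f (x , y)))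
∑-cartesianProduct []       ys f = refl
∑-cartesianProduct (x ∷ xs) ys f = trans (∑-++ (map (x ,_) ys) _ f)
  (cong₂ _+_ (∑-map (x ,_) ys f) (∑-cartesianProduct xs ys f))

-- `R` is the graph of an injection given by witnesses, so no function has to be named. The image of
-- the first element is cut out of `ys`; injectivity and uniqueness of `xs` keep the other images in
-- what remains.
∑-injection : (R : I → J → Set) → (∀ {x x′ y} → R x y → R x′ y → x ≡ x′) →
              {f : I → ℕ} {h : J → ℕ} {xs : List I} → Unique xs → (ys : List J) →
              (∀ {x} → x ∈ˡ xs → Σ J λ y → y ∈ˡ ys × R x y × f x ≤ h y) → ∑ xs f ≤ ∑ ys h
∑-injection R inj AllPairs.[] ys img = z≤n
∑-injection R inj {f} {h} {x ∷ xs} (x≢xs AllPairs.∷ uniq) ys img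
  with y , y∈ , Rxy , fx≤hy ← img (here refl) with as , bs , refl ← ∈-∃++ y∈ = begin
    f x + ∑ xs f              ≤⟨ +-mono-≤ fx≤hy (∑-injection R inj uniq (as ++ bs) img′) ⟩
    h y + ∑ (as ++ bs) h      ≡⟨ cong (h y +_) (∑-++ as bs h) ⟩
    h y + (∑ as h + ∑ bs h)   ≡⟨ rearrange (h y) (∑ as h) (∑ bs h) ⟩
    ∑ as h + (h y + ∑ bs h)   ≡⟨ ∑-++ as (y ∷ bs) h ⟨
    ∑ (as ++ y ∷ bs) h        ∎
  where
  open ≤-Reasoning
  rearrange : ∀ a b c → a + (b + c) ≡ b + (a + c)
  rearrange a b c = solve (a ∷ b ∷ c ∷ [])
  img′ : ∀ {x′} → x′ ∈ˡ xs → Σ _ λ y′ → y′ ∈ˡ as ++ bs × R x′ y′ × f x′ ≤ h y′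
  img′ {x′} x′∈ with img (there x′∈)
  ... | y′ , y′∈ , Rx′y′ , le with ∈-++⁻ as y′∈
  ...   | inj₁ y′∈as            = y′ , ∈-++⁺ˡ y′∈as , Rx′y′ , le
  ...   | inj₂ (there y′∈bs)    = y′ , ∈-++⁺ʳ as y′∈bs , Rx′y′ , le
  ...   | inj₂ (here refl)      = ⊥-elim (All.lookup x≢xs x′∈ (inj Rxy Rx′y′))

∑-max : (xs : List I) (f : I → ℕ) → 0 < length xs → Σ I λ x → x ∈ˡ xs × ∑ xs f ≤ length xs * f x
∑-max (x ∷ [])          f _ = x , here refl , ≤-refl
∑-max (x ∷ xs@(_ ∷ _)) f _ with ∑-max xs f z<s
... | y , y∈ , le with ≤-total (f x) (f y)
...   | inj₁ fx≤fy = y , there y∈ , +-mono-≤ fx≤fy le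
...   | inj₂ fy≤fx = x , here refl , +-monoʳ-≤ (f x) (≤-trans le (*-monoʳ-≤ (length xs) fy≤fx))

-- Enumerating vertices and offers

elems : Subset n → List (Fin n)
elems Vec.[]            = []
elems (true  Vec.∷ p) = zero ∷ map suc (elems p)
elems (false Vec.∷ p) = map suc (elems p)

length-elems : (p : Subset n) → length (elems p) ≡ ∣ p ∣
length-elems Vec.[]            = refl
length-elems (true  Vec.∷ p) = cong suc (trans (length-map suc (elems p)) (length-elems p))
length-elems (false Vec.∷ p) = trans (length-map suc (elems p)) (length-elems p)

∈-elems⁺ : {p : Subset n} {x : Fin n} → x ∈ p → x ∈ˡ elems p
∈-elems⁺ {p = true  Vec.∷ p} here       = here refl
∈-elems⁺ {p = true  Vec.∷ p} (there x∈) = there (∈-map⁺ suc (∈-elems⁺ x∈))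
∈-elems⁺ {p = false Vec.∷ p} (there x∈) = ∈-map⁺ suc (∈-elems⁺ x∈)

∈-elems⁻ : (p : Subset n) {x : Fin n} → x ∈ˡ elems p → x ∈ p
∈-elems⁻ (true  Vec.∷ p) (here refl) = here
∈-elems⁻ (true  Vec.∷ p) (there x∈) with y , y∈ , refl ← ∈-map⁻ suc x∈ = there (∈-elems⁻ p y∈)
∈-elems⁻ (false Vec.∷ p) x∈         with y , y∈ , refl ← ∈-map⁻ suc x∈ = there (∈-elems⁻ p y∈)

elems-unique : (p : Subset n) → Unique (elems p)
elems-unique Vec.[]            = AllPairs.[]
elems-unique (true  Vec.∷ p) = All.map⁺ (All.tabulate λ _ ()) AllPairs.∷ Unique.map⁺ Fin.suc-injective
  (elems-unique p)
elems-unique (false Vec.∷ p) = Unique.map⁺ Fin.suc-injective (elems-unique p)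

Offer-≡ : {O O′ : Offer n r} → proj₁ O ≡ proj₁ O′ → O ≡ O′
Offer-≡ {O = S , p} {O′ = .S , q} refl = cong (S ,_) (≡-irrelevant p q)

private
  out : Offer n r → Offer (suc n) r
  out (S , eq) = false Vec.∷ S , eq

  inn : Offer n r → Offer (suc n) (suc r)
  inn (S , eq) = true Vec.∷ S , cong suc eq

offers : ∀ n r → List (Offer n r)
offers zero    zero    = (Vec.[] , refl) ∷ []
offers zero    (suc r) = []
offers (suc n) zero    = map out (offers n zero)
offers (suc n) (suc r) = map inn (offers n r) ++ map out (offers n (suc r))

length-offers : ∀ n r → length (offers n r) ≡ n C r
length-offers zero    zero    = refl
length-offers zero    (suc r) = refl
length-offers (suc n) zero    = trans (length-map out (offers n zero)) (length-offers n zero)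
length-offers (suc n) (suc r) = begin
  length (map inn (offers n r) ++ map out (offers n (suc r)))        ≡⟨ length-++ (map inn (offers n r)) ⟩
  length (map inn (offers n r)) + length (map out (offers n (suc r))) ≡⟨ cong₂ _+_ (length-map inn
    (offers n r)) (length-map out (offers n (suc r))) ⟩
  length (offers n r) + length (offers n (suc r))                     ≡⟨ cong₂ _+_ (length-offers n r)
    (length-offers n (suc r)) ⟩
  n C r + n C suc r                                                   ≡⟨ nCk+nC[k+1]≡[n+1]C[k+1] n r ⟩
  suc n C suc r                                                       ∎
  where open ≡-Reasoning

length-offers≤ : ∀ n r → length (offers n r) ≤ n ^ r
length-offers≤ zero    zero    = ≤-refl
length-offers≤ zero    (suc r) = z≤n
length-offers≤ (suc n) zero    = ≤-trans (≤-reflexive (length-map out (offers n zero)))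
  (length-offers≤ n zero)
length-offers≤ (suc n) (suc r) = begin
  length (map inn (offers n r) ++ map out (offers n (suc r)))        ≡⟨ length-++ (map inn (offers n r)) ⟩
  length (map inn (offers n r)) + length (map out (offers n (suc r))) ≡⟨ cong₂ _+_ (length-map inn
    (offers n r)) (length-map out (offers n (suc r))) ⟩
  length (offers n r) + length (offers n (suc r))                     ≤⟨ +-mono-≤ (length-offers≤ n r)
    (length-offers≤ n (suc r)) ⟩
  suc n * n ^ r                                                       ≤⟨ *-monoʳ-≤ (suc n) (^-monoˡ-≤ r
    (n≤1+n n)) ⟩
  suc n ^ suc r                                                       ∎
  where open ≤-Reasoning

offers-complete : (O : Offer n r) → O ∈ˡ offers n r
offers-complete {zero}  {zero}  (Vec.[] , refl)        = here refl
offers-complete {suc n} {zero}  (false Vec.∷ S , eq) = ∈-map⁺ out (offers-complete (S , eq))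
offers-complete {suc n} {suc r} (false Vec.∷ S , eq) = ∈-++⁺ʳ _ (∈-map⁺ out (offers-complete (S , eq)))
offers-complete {suc n} {suc r} (true  Vec.∷ S , eq) =
  ∈-++⁺ˡ (subst (_∈ˡ map inn (offers n r)) (Offer-≡ refl) (∈-map⁺ inn (offers-complete (S ,
    suc-injective eq))))

offers-unique : ∀ n r → Unique (offers n r)
offers-unique zero    zero    = All.[] AllPairs.∷ AllPairs.[]
offers-unique zero    (suc r) = AllPairs.[]
offers-unique (suc n) zero    = Unique.map⁺ (λ eq → Offer-≡ (Vec.∷-injectiveʳ (cong proj₁ eq)))
  (offers-unique n zero)
offers-unique (suc n) (suc r) = Unique.++⁺
  (Unique.map⁺ (λ eq → Offer-≡ (Vec.∷-injectiveʳ (cong proj₁ eq))) (offers-unique n r))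
  (Unique.map⁺ (λ eq → Offer-≡ (Vec.∷-injectiveʳ (cong proj₁ eq))) (offers-unique n (suc r)))
  λ { (∈in , ∈out) → disjoint ∈in ∈out }
  where
  disjoint : ∀ {O} → O ∈ˡ map inn (offers n r) → O ∈ˡ map out (offers n (suc r)) → Empty.⊥
  disjoint ∈in ∈out with _ , _ , refl ← ∈-map⁻ inn ∈in with _ , _ , () ← ∈-map⁻ out ∈out


-- Simulating a random pair

record Pick (P Q O : Subset n) : Set where
  constructor pick
  field
    a b  : Fin n
    a∈P  : a ∈ P
    b∈Q  : b ∈ Q
    -- Inclusion instead of equality, so that a single offered vertex can be completed to a pair by
    -- choice.
    O⊆ab : O ⊆ ⁅ a ⁆ ∪ ⁅ b ⁆

reward : {P Q O : Subset n} → (Fin n → Fin n → ℕ) → Maybe (Pick P Q O) → ℕ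
reward g nothing  = 0
reward g (just p) = g (Pick.a p) (Pick.b p)

pair-injective : {P Q : Subset n} → Apart P Q → ∀ {a b a′ b′ : Fin n} → a ∈ P → b ∈ Q → a′ ∈ P → b′ ∈ Q →
                 ⁅ a ⁆ ∪ ⁅ b ⁆ ≡ ⁅ a′ ⁆ ∪ ⁅ b′ ⁆ → a ≡ a′ × b ≡ b′
pair-injective {P = P} {Q} apart {a} {b} {a′} {b′} a∈P b∈Q a′∈P b′∈Q eq = a≡a′ , b≡b′
  where
  a≡a′ : a ≡ a′
  a≡a′ with x∈p∪q⁻ ⁅ a′ ⁆ ⁅ b′ ⁆ (subst (a ∈_) eq (x∈p∪q⁺ (inj₁ (x∈⁅x⁆ a))))
  ... | inj₁ a∈ = x∈⁅y⁆⇒x≡y a′ a∈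
  ... | inj₂ a∈ = ⊥-elim (apart a∈P (subst (_∈ Q) (sym (x∈⁅y⁆⇒x≡y b′ a∈)) b′∈Q))
  b≡b′ : b ≡ b′
  b≡b′ with x∈p∪q⁻ ⁅ a′ ⁆ ⁅ b′ ⁆ (subst (b ∈_) eq (x∈p∪q⁺ (inj₂ (x∈⁅x⁆ b))))
  ... | inj₂ b∈ = x∈⁅y⁆⇒x≡y b′ b∈
  ... | inj₁ b∈ = ⊥-elim (apart (subst (_∈ P) (sym (x∈⁅y⁆⇒x≡y a′ b∈)) a′∈P) b∈Q)

-- Whether the model offers one vertex or two, the player can answer with a pair
-- (a, b) ∈ P × Q containing the offer so that, up to the factor ∣P∣∣Q∣/n², the
-- expected weight is at least that of a uniformly random pair.
Sampling : (n r : ℕ) → Set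
Sampling n r = {P Q : Subset n} → Apart P Q → (g : Fin n → Fin n → ℕ) →
  Σ ((O : Offer n r) → Maybe (Pick P Q (proj₁ O))) λ e →
    length (offers n r) * ∑ (elems P) (λ a → ∑ (elems Q) (g a)) ≤
    n * n * ∑ (offers n r) (λ O → reward g (e O))

-- Only offers with one vertex in `P` and one in `Q` are answered, by themselves. Since `P` and `Q`
-- are apart, distinct pairs are distinct offers, and there are at most `n * n` offers in all.
sampling₂ : ∀ n → Sampling n 2
sampling₂ n {P} {Q} apart g = e , (begin
  length (offers n 2) * ∑ (elems P) (λ a → ∑ (elems Q) (g a))   ≤⟨ *-mono-≤ (≤-trans (length-offers≤ n 2)
    (≤-reflexive (cong (n *_) (*-identityʳ n)))) total ⟩
  n * n * ∑ (offers n 2) (λ O → reward g (e O))                 ∎)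
  where
  open ≤-Reasoning
  Hit : Subset n → Set
  Hit O = ∃ λ a → ∃ λ b → a ∈ P × b ∈ Q × O ≡ ⁅ a ⁆ ∪ ⁅ b ⁆
  hit? : ∀ O → Dec (Hit O)
  hit? O = any? λ a → any? λ b → (a ∈? P) ×-dec (b ∈? Q) ×-dec Vec.≡-dec Bool._≟_ O (⁅ a ⁆ ∪ ⁅ b ⁆)
  answer : ∀ {O} → Dec (Hit O) → Maybe (Pick P Q O)
  answer (no _)                       = nothing
  answer (yes (a , b , a∈ , b∈ , eq)) = just (pick a b a∈ b∈ (⊆-reflexive eq))
  e : (O : Offer n 2) → Maybe (Pick P Q (proj₁ O))
  e O = answer (hit? (proj₁ O))
  hit-reward : ∀ {a b} → a ∈ P → b ∈ Q → (h : Dec (Hit (⁅ a ⁆ ∪ ⁅ b ⁆))) → g a b ≤ reward g (answer h)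
  hit-reward {a} {b} a∈P b∈Q (no ¬hit) = ⊥-elim (¬hit (a , b , a∈P , b∈Q , refl))
  hit-reward {a} {b} a∈P b∈Q (yes (a′ , b′ , a′∈ , b′∈ , eq)) =
    let (a≡a′ , b≡b′) = pair-injective apart a∈P b∈Q a′∈ b′∈ eq in ≤-reflexive (cong₂ g a≡a′ b≡b′)
  R : Fin n × Fin n → Offer n 2 → Set
  R (a , b) O = a ∈ P × b ∈ Q × proj₁ O ≡ ⁅ a ⁆ ∪ ⁅ b ⁆
  R-injective : ∀ {i j O} → R i O → R j O → i ≡ j
  R-injective (a∈ , b∈ , eq) (a′∈ , b′∈ , eq′) =
    let (a≡a′ , b≡b′) = pair-injective apart a∈ b∈ a′∈ b′∈ (trans (sym eq) eq′) in cong₂ _,_ a≡a′ b≡b′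
  image : ∀ {i} → i ∈ˡ cartesianProduct (elems P) (elems Q) →
          Σ (Offer n 2) λ O → O ∈ˡ offers n 2 × R i O × uncurry g i ≤ reward g (e O)
  image {a , b} i∈ with a∈ , b∈ ← ∈-cartesianProduct⁻ (elems P) (elems Q) i∈ =
    O , offers-complete O , (a∈P , b∈Q , refl) , hit-reward a∈P b∈Q (hit? (proj₁ O))
    where
    a∈P = ∈-elems⁻ P a∈
    b∈Q = ∈-elems⁻ Q b∈
    a⊥b : Apart ⁅ a ⁆ ⁅ b ⁆
    a⊥b x∈a x∈b = apart (⁅x⁆⊆p a∈P x∈a) (⁅x⁆⊆p b∈Q x∈b)
    O : Offer n 2
    O = ⁅ a ⁆ ∪ ⁅ b ⁆ , trans (∣p∪q∣≡∣p∣+∣q∣ a⊥b) (cong₂ _+_ (∣⁅x⁆∣≡1 a) (∣⁅x⁆∣≡1 b))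
  total : ∑ (elems P) (λ a → ∑ (elems Q) (g a)) ≤ ∑ (offers n 2) (λ O → reward g (e O))
  total = ≤-trans (≤-reflexive (sym (∑-cartesianProduct (elems P) (elems Q) (uncurry g))))
    (∑-injection R (λ {i} {j} {O} → R-injective {i} {j} {O})
      (Unique.cartesianProduct⁺ (elems-unique P) (elems-unique Q)) (offers n 2) image)

-- An offered `b ∈ Q` is completed by the `a ∈ P` that maximises `g a b`. This maximum is at least
-- the average over `P`, hence at least the column sum divided by `n`.
sampling₁ : ∀ n → Sampling n 1
sampling₁ n {P} {Q} apart g with nonempty? P
... | no ¬ne = (λ _ → nothing) , ≤-trans (≤-reflexive zero-sum) z≤n
  where
  P≡⊥ : elems P ≡ []
  P≡⊥ with elems P in eq
  ... | []     = refl
  ... | x ∷ xs = ⊥-elim (¬ne (x , ∈-elems⁻ P (subst (x ∈ˡ_) (sym eq) (here refl))))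
  zero-sum : length (offers n 1) * ∑ (elems P) (λ a → ∑ (elems Q) (g a)) ≡ 0
  zero-sum = trans (cong (λ as → length (offers n 1) * ∑ as (λ a → ∑ (elems Q) (g a))) P≡⊥) (*-zeroʳ (length
    (offers n 1)))
... | yes (a₀ , a₀∈P) = e , (begin
  length (offers n 1) * ∑ (elems P) (λ a → ∑ (elems Q) (g a))
    ≡⟨ cong₂ _*_ (trans (length-offers n 1) (nC1≡n n)) (∑-swap (elems P) (elems Q) g) ⟩
  n * ∑ (elems Q) (λ b → ∑ (elems P) (λ a → g a b))
    ≤⟨ *-monoʳ-≤ n (∑-mono (elems Q) (λ b → ≤-trans (proj₂ (proj₂ (best b))) (*-monoˡ-≤ (g
      (a* b) b) P≤n))) ⟩
  n * ∑ (elems Q) (λ b → n * g (a* b) b)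
    ≡⟨ cong (n *_) (∑-* n (elems Q) (λ b → g (a* b) b)) ⟩
  n * (n * ∑ (elems Q) (λ b → g (a* b) b))
    ≡⟨ *-assoc n n _ ⟨
  n * n * ∑ (elems Q) (λ b → g (a* b) b)
    ≤⟨ *-monoʳ-≤ (n * n) total ⟩
  n * n * ∑ (offers n 1) (λ O → reward g (e O)) ∎)
  where
  open ≤-Reasoning
  P≤n : length (elems P) ≤ n
  P≤n = ≤-trans (≤-reflexive (length-elems P)) (∣p∣≤n P)
  0<P : 0 < length (elems P)
  0<P with _ ∷ _ ← elems P | _ ← ∈-elems⁺ a₀∈P = z<s
  best : ∀ b → Σ (Fin n) λ a → a ∈ˡ elems P × ∑ (elems P) (λ a → g a b) ≤ length (elems P) * g a b
  best b = ∑-max (elems P) (λ a → g a b) 0<P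
  a* : Fin n → Fin n
  a* b = proj₁ (best b)
  Hit : Subset n → Set
  Hit O = ∃ λ b → b ∈ Q × O ≡ ⁅ b ⁆
  hit? : ∀ O → Dec (Hit O)
  hit? O = any? λ b → (b ∈? Q) ×-dec Vec.≡-dec Bool._≟_ O ⁅ b ⁆
  answer : ∀ {O} → Dec (Hit O) → Maybe (Pick P Q O)
  answer (no _)             = nothing
  answer (yes (b , b∈ , eq)) = just (pick (a* b) b (∈-elems⁻ P (proj₁ (proj₂ (best b)))) b∈
    (λ x∈ → q⊆p∪q ⁅ a* b ⁆ ⁅ b ⁆ (⊆-reflexive eq x∈)))
  e : (O : Offer n 1) → Maybe (Pick P Q (proj₁ O))
  e O = answer (hit? (proj₁ O))
  ⁅⁆-injective : ∀ {b b′ : Fin n} → ⁅ b ⁆ ≡ ⁅ b′ ⁆ → b ≡ b′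
  ⁅⁆-injective {b} {b′} eq = x∈⁅y⁆⇒x≡y b′ (subst (b ∈_) eq (x∈⁅x⁆ b))
  hit-reward : ∀ {b} → b ∈ Q → (h : Dec (Hit ⁅ b ⁆)) → g (a* b) b ≤ reward g (answer h)
  hit-reward {b} b∈Q (no ¬hit) = ⊥-elim (¬hit (b , b∈Q , refl))
  hit-reward {b} b∈Q (yes (b′ , b′∈ , eq)) = ≤-reflexive (cong (λ b → g (a* b) b) (⁅⁆-injective eq))
  total : ∑ (elems Q) (λ b → g (a* b) b) ≤ ∑ (offers n 1) (λ O → reward g (e O))
  total = ∑-injection (λ b O → proj₁ O ≡ ⁅ b ⁆) (λ eq eq′ → ⁅⁆-injective (trans (sym eq) eq′))
    (elems-unique Q) (offers n 1)
    λ {b} b∈ → (⁅ b ⁆ , ∣⁅x⁆∣≡1 b) , offers-complete _ , refl , hit-reward (∈-elems⁻ Q b∈) (hit? ⁅ b ⁆)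

-- Strategies as games

record Edge {n r} (u : ℕ) (O : Offer n r) : Set where
  constructor edge
  field
    E   : Subset n
    O⊆E : proj₁ O ⊆ E
    ∣E∣ : ∣ E ∣ ≡ u

extend : {O : Offer n r} → List (Subset n) → Maybe (Edge u O) → List (Subset n)
extend H nothing        = H
extend H (just e) = Edge.E e ∷ H

-- H lists the hyperedges built so far. A position `lost` is one that is given up:
-- it makes no claim and is only counted by `loss`.
data Game (n r u : ℕ) : ℕ → List (Subset n) → Set where
  won  : HasPerfectMatching H → Game n r u 0 H
  lost : Game n r u 0 H
  turn : (move : (O : Offer n r) → Maybe (Edge u O)) →
         (∀ O → Game n r u L (extend H (move O))) → Game n r u (suc L) H

-- The leaves `won` and `lost` occur only when no rounds remain, so this is the number of offer
-- sequences that end in a lost position.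
loss : Game n r u L H → ℕ
loss (won _)                     = 0
loss lost                        = 1
loss {n} {r} (turn move next) = ∑ (offers n r) (λ O → loss (next O))

wins : Game n r u L H → List (Vec (Offer n r) L)
winsFrom : (move : (O : Offer n r) → Maybe (Edge u O)) → (∀ O → Game n r u L (extend H (move O))) →
           Offer n r → List (Vec (Offer n r) (suc L))

wins (won _)                     = Vec.[] ∷ []
wins lost                        = []
wins {n} {r} {H = H} (turn move next) = concat (map (winsFrom {H = H} move next) (offers n r))

winsFrom move next O = map (O Vec.∷_) (wins (next O))

∈-wins⁻ : (move : (O : Offer n r) → Maybe (Edge u O)) (next : ∀ O → Game n r u L (extend H (move O))) →
          ∀ {ω} → ω ∈ˡ wins (turn move next) → Σ (Offer n r) λ O → ∃ λ ω′ → ω ≡ O Vec.∷ ω′ × ω′ ∈ˡ wins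
            (next O)
∈-wins⁻ {n} {r} {H = H} move next ω∈ with ∈-concat⁻′ (map (winsFrom {H = H} move next) (offers n r)) ω∈
... | ωs , ω∈ωs , ωs∈ with ∈-map⁻ (winsFrom {H = H} move next) ωs∈
...   | O , _ , refl with ∈-map⁻ (O Vec.∷_) ω∈ωs
...     | ω′ , ω′∈ , eq = O , ω′ , eq , ω′∈

length-concat-map : {A B : Set} (f : A → List B) (xs : List A) → length (concat (map f xs)) ≡ ∑ xs (λ x →
  length (f x))
length-concat-map f []       = refl
length-concat-map f (x ∷ xs) = trans (length-++ (f x)) (cong (length (f x) +_) (length-concat-map f xs))

length-wins : (g : Game n r u L H) → length (wins g) + loss g ≡ length (offers n r) ^ L
length-wins (won _) = refl
length-wins lost    = refl
length-wins {n} {r} {L = suc L} (turn move next) = begin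
  length (wins (turn move next)) + ∑ Ω (λ O → loss (next O))
    ≡⟨ cong (_+ ∑ Ω (λ O → loss (next O))) (length-concat-map _ Ω) ⟩
  ∑ Ω (λ O → length (map (O Vec.∷_) (wins (next O)))) + ∑ Ω (λ O → loss (next O))
    ≡⟨ ∑-+ Ω _ _ ⟨
  ∑ Ω (λ O → length (map (O Vec.∷_) (wins (next O))) + loss (next O))
    ≡⟨ ∑-cong Ω (λ O → trans (cong (_+ loss (next O)) (length-map (O Vec.∷_) (wins (next O)))) (length-wins
      (next O))) ⟩
  ∑ Ω (λ _ → length Ω ^ L)
    ≡⟨ ∑-const (length Ω ^ L) Ω ⟩
  length Ω ^ suc L ∎
  where
  open ≡-Reasoning
  Ω = offers n r

wins-unique : (g : Game n r u L H) → Unique (wins g)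
wins-unique (won _) = All.[] AllPairs.∷ AllPairs.[]
wins-unique lost    = AllPairs.[]
wins-unique {n} {r} {H = H} (turn move next) = Unique.concat⁺
  (All.map⁺ (All.tabulate λ {O} _ → Unique.map⁺ Vec.∷-injectiveʳ (wins-unique (next O))))
  (AllPairs.map⁺ (AllPairs.map disjoint (offers-unique n r)))
  where
  disjoint : ∀ {O O′} → O ≢ O′ → ∀ {ω} →
    ω ∈ˡ winsFrom {H = H} move next O × ω ∈ˡ winsFrom {H = H} move next O′ → Empty.⊥
  disjoint {O} {O′} O≢O′ (ω∈ , ω∈′) with _ , _ , refl ← ∈-map⁻ (O Vec.∷_) ω∈ with _ , _ , eq ← ∈-map⁻
    (O′ Vec.∷_) ω∈′ =
    O≢O′ (Vec.∷-injectiveˡ eq)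

respond : {O : Offer n r} → Edge u O → Response u O
respond {r = r} {u} {O = O , ∣O∣} (edge E O⊆E ∣E∣) =
  E ─ O , Apart⇒∩≡⊥ (λ x∈O x∈E─O → x∈p─q⇒x∉q E O x∈E─O x∈O) , (begin
    ∣ E ─ O ∣               ≡⟨ m+n∸n≡m (∣ E ─ O ∣) (∣ O ∣) ⟨
    ∣ E ─ O ∣ + ∣ O ∣ ∸ ∣ O ∣ ≡⟨ cong₂ _∸_ (trans (∣p─q∣+∣q∣≡∣p∣ O⊆E) ∣E∣) ∣O∣ ⟩
    u ∸ r                   ∎)
  where open ≡-Reasoning

∪-respond : {O : Offer n r} (e : Edge u O) → proj₁ O ∪ proj₁ (respond e) ≡ Edge.E e
∪-respond {O = O , _} (edge E O⊆E _) = ⊆-antisym (∪-⊆ O⊆E (p─q⊆p E O)) λ {x} x∈E → to x∈E (x ∈? O)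
  where
  to : ∀ {x} → x ∈ E → Dec (x ∈ O) → x ∈ O ∪ (E ─ O)
  to x∈E (yes x∈O) = x∈p∪q⁺ (inj₁ x∈O)
  to x∈E (no  x∉O) = x∈p∪q⁺ (inj₂ (x∈p∧x∉q⇒x∈p─q x∈E x∉O))

-- The history is replayed along the game tree to find the current move. Offers after the end of the
-- game are ignored.
follow : Game n r u L H → List (Offer n r) → (O : Offer n r) → Maybe (Response u O)
follow (won _)          h        O = nothing
follow lost             h        O = nothing
follow (turn move next) []       O = Maybe.map respond (move O)
follow (turn move next) (O′ ∷ h) O = follow (next O′) h O

module _ (σ : Strategy u r) (h : List (Offer n r)) (O : Offer n r) (os : List (Offer n r)) where

  play-later : ∀ {E} → E ∈ˡ play σ n (h ++ [ O ]) os → E ∈ˡ play σ n h (O ∷ os)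
  play-later E∈ with σ n h O
  ... | nothing = E∈
  ... | just _  = there E∈

  play-now : (R : Response u O) → σ n h O ≡ just R → proj₁ O ∪ proj₁ R ∈ˡ play σ n h (O ∷ os)
  play-now R eq with σ n h O
  play-now R refl | just .R = here refl

HasPerfectMatching-⊆ : {H K : List (Subset n)} → (∀ {E} → E ∈ˡ H → E ∈ˡ K) →
                       HasPerfectMatching H → HasPerfectMatching K
HasPerfectMatching-⊆ H⊆K (M , M⊆H , disjoint , cover) = M , All.map H⊆K M⊆H , disjoint , cover

-- `K` stands for the final hypergraph and stays fixed in the induction. It suffices that it
-- contains both the hyperedges built so far and those still to be played.
follow-wins : (σ : Strategy u r) (g : Game n r u L H) (h : List (Offer n r)) →
              (∀ h′ O → σ n (h ++ h′) O ≡ follow g h′ O) →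
              (K : List (Subset n)) → (∀ {E} → E ∈ˡ H → E ∈ˡ K) →
              ∀ {ω} → ω ∈ˡ wins g → (∀ {E} → E ∈ˡ play σ n h (toList ω) → E ∈ˡ K) → HasPerfectMatching K
follow-wins σ (won pm) h σ≡ K H⊆K ω∈ play⊆K = HasPerfectMatching-⊆ H⊆K pm
follow-wins {n = n} {H = H} σ (turn move next) h σ≡ K H⊆K ω∈ play⊆K
  with O , ω , refl , ω∈′ ← ∈-wins⁻ move next ω∈ =
  follow-wins {H = extend H (move O)} σ (next O) (h ++ [ O ])
    (λ h′ O′ → trans (cong (λ h → σ n h O′) (++-assoc h [ O ] h′)) (σ≡ (O ∷ h′) O′))
    K (λ {E} → extend⊆K (move O) refl) ω∈′ (λ E∈ → play⊆K (play-later σ h O (toList ω) E∈))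
  where
  extend⊆K : ∀ m → move O ≡ m → ∀ {E} → E ∈ˡ extend H m → E ∈ˡ K
  extend⊆K nothing  eq E∈ = H⊆K E∈
  extend⊆K (just E) eq (there E∈) = H⊆K E∈
  extend⊆K (just E) eq (here refl) = play⊆K (subst (_∈ˡ _) (∪-respond E)
    (play-now σ h O (toList ω) (respond E)
      (trans (cong (λ h → σ n h O) (sym (++-identityʳ h))) (trans (σ≡ [] O) (cong
        (Maybe.map respond) eq)))))

losing : ∀ L → Game n r u L H
losing zero    = lost
losing (suc L) = turn (λ _ → nothing) (λ _ → losing L)

loss≤ : (g : Game n r u L H) → loss g ≤ length (offers n r) ^ L
loss≤ g = ≤-trans (m≤n+m (loss g) _) (≤-reflexive (length-wins g))

-- The `bound` says that the average of `φ` over the next offer is at most `k / (1 + k)` times its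
-- present value, with denominators cleared.
record Step {n} r u {H} (k : ℕ) (St : List (Subset n) → Set) (φ : ∀ {H} → St H → ℕ) (st : St H) : Set where
  field
    move  : (O : Offer n r) → Maybe (Edge u O)
    next  : ∀ O → St (extend H (move O))
    bound : suc k * ∑ (offers n r) (λ O → φ (next O)) ≤ k * (length (offers n r) * φ st)

-- Markov's inequality for the supermartingale φ: after L₀ rounds the fraction of
-- histories with φ ≠ 0 is at most (k/(1+k))^L₀ φ(st); the others go on to a game which
-- loses at most the fraction b/w.
module _ {n r u k : ℕ} {St : List (Subset n) → Set} {φ : ∀ {H} → St H → ℕ}
         (step : ∀ {H} (st : St H) → 0 < φ st → Step r u k St φ st)
         {L w b : ℕ} (finish : ∀ {H} (st : St H) → φ st ≡ 0 → Σ (Game n r u L H) λ g → w * loss g ≤ b) where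

  private
    Ω = length (offers n r)

    step′ : ∀ {H} (st : St H) → Step r u k St φ st
    step′ st with φ st in eq
    ... | suc _ = step st (subst (0 <_) (sym eq) z<s)
    -- Once the potential is zero, offers are ignored and the state stays as it is until the rounds
    -- of this phase are used up.
    ... | zero  = record
      { move  = λ _ → nothing
      ; next  = λ _ → st
      ; bound = ≤-trans (≤-reflexive (trans (cong (suc k *_) (trans (∑-const (φ st) (offers n r))
                  (trans (cong (Ω *_) eq) (*-zeroʳ Ω)))) (*-zeroʳ (suc k)))) z≤n }

  iterate : ∀ L₀ {H} (st : St H) → Σ (Game n r u (L₀ + L) H) λ g →
            suc k ^ L₀ * (w * loss g) ≤ k ^ L₀ * w * Ω ^ (L₀ + L) * φ st + suc k ^ L₀ * Ω ^ L₀ * b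
  iterate zero st with φ st in eq
  ... | zero = let (g , le) = finish st eq in g , (begin
    1 * (w * loss g)                     ≡⟨ *-identityˡ _ ⟩
    w * loss g                           ≤⟨ le ⟩
    b                                    ≡⟨ *-identityˡ b ⟨
    1 * b                                ≤⟨ m≤n+m (1 * b) (1 * w * Ω ^ L * 0) ⟩
    1 * w * Ω ^ L * 0 + 1 * b            ∎)
    where open ≤-Reasoning
  -- A nonzero potential is at least one, so even losing all `Ω ^ L` continuations is paid for by
  -- the first summand.
  ... | suc f = losing L , (begin
    1 * (w * loss {n} {r} {u} (losing L))      ≡⟨ *-assoc 1 w _ ⟨
    1 * w * loss {n} {r} {u} (losing L)        ≤⟨ *-monoʳ-≤ (1 * w) (loss≤ {n} {r} {u} (losing L)) ⟩
    1 * w * Ω ^ L                        ≤⟨ m≤m*n (1 * w * Ω ^ L) (suc f) ⟩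
    1 * w * Ω ^ L * suc f                ≤⟨ m≤m+n _ (1 * b) ⟩
    1 * w * Ω ^ L * suc f + 1 * b        ∎)
    where open ≤-Reasoning
  iterate (suc L₀) {H} st = turn move (λ O → proj₁ (rec O)) , (begin
    suc k ^ suc L₀ * (w * ∑ Os ℓ)
      ≡⟨ *-assoc (suc k) (suc k ^ L₀) _ ⟩
    suc k * (suc k ^ L₀ * (w * ∑ Os ℓ))
      ≡⟨ cong (suc k *_) (trans (∑-* (suc k ^ L₀) Os (λ O → w * ℓ O)) (cong (suc k ^ L₀ *_) (∑-* w Os ℓ))) ⟨
    suc k * ∑ Os (λ O → suc k ^ L₀ * (w * ℓ O))
      ≤⟨ *-monoʳ-≤ (suc k) (∑-mono Os (λ O → proj₂ (rec O))) ⟩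
    suc k * ∑ Os (λ O → X * φ (next O) + Y)
      ≡⟨ cong (suc k *_) (trans (∑-+ Os (λ O → X * φ (next O)) (λ _ → Y)) (cong₂ _+_ (∑-* X Os (λ O → φ
        (next O))) (∑-const Y Os))) ⟩
    suc k * (X * ∑ Os (λ O → φ (next O)) + Ω * Y)
      ≡⟨ rearrange (suc k) X (∑ Os (λ O → φ (next O))) (Ω * Y) ⟩
    X * (suc k * ∑ Os (λ O → φ (next O))) + suc k * (Ω * Y)
      ≤⟨ +-monoˡ-≤ (suc k * (Ω * Y)) (*-monoʳ-≤ X bound) ⟩
    X * (k * (Ω * φ st)) + suc k * (Ω * Y)
      ≡⟨ collect k (suc k) (k ^ L₀) (suc k ^ L₀) (Ω ^ L₀) (Ω ^ (L₀ + L)) Ω w b (φ st) ⟩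
    k ^ suc L₀ * w * Ω ^ (suc L₀ + L) * φ st + suc k ^ suc L₀ * Ω ^ suc L₀ * b ∎)
    where
    open ≤-Reasoning
    open Step (step′ st)
    Os = offers n r
    rec : ∀ O → Σ (Game n r u (L₀ + L) (extend H (move O))) λ g →
          suc k ^ L₀ * (w * loss g) ≤ k ^ L₀ * w * Ω ^ (L₀ + L) * φ (next O) + suc k ^ L₀ * Ω ^ L₀ * b
    rec O = iterate L₀ {extend H (move O)} (next O)
    ℓ : Offer n r → ℕ
    ℓ O = loss (proj₁ (rec O))
    X = k ^ L₀ * w * Ω ^ (L₀ + L)
    Y = suc k ^ L₀ * Ω ^ L₀ * b
    rearrange : ∀ K x y z → K * (x * y + z) ≡ x * (K * y) + K * z
    rearrange K x y z = solve (K ∷ x ∷ y ∷ z ∷ [])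
    collect : ∀ k K kp Kp Ωp Ωq Ω w b f → kp * w * Ωq * (k * (Ω * f)) + K * (Ω * (Kp * Ωp * b)) ≡
              k * kp * w * (Ω * Ωq) * f + K * Kp * (Ω * Ωp) * b
    collect k K kp Kp Ωp Ωq Ω w b f = solve (k ∷ K ∷ kp ∷ Kp ∷ Ωp ∷ Ωq ∷ Ω ∷ w ∷ b ∷ f ∷ [])

-- First phase

-- `R` is the total decrease of the potential over all offers. It is at least the fraction `D / N`,
-- hence at least `1 / (1 + k)`, of `Ω * φ`; what is left is `φ′`.
drift : ∀ {k N D Ω φ φ′ R} → 0 < D → N ≤ suc k * D → Ω * D * φ ≤ N * R → φ′ + R ≡ Ω * φ →
        suc k * φ′ ≤ k * (Ω * φ)
drift {k} {N} {D@(suc _)} {Ω} {φ} {φ′} {R} _ N≤KD gain total =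
  +-cancelʳ-≤ (Ω * φ) (suc k * φ′) (k * (Ω * φ)) (begin
    suc k * φ′ + Ω * φ      ≤⟨ +-monoʳ-≤ (suc k * φ′) Ωφ≤KR ⟩
    suc k * φ′ + suc k * R  ≡⟨ *-distribˡ-+ (suc k) φ′ R ⟨
    suc k * (φ′ + R)        ≡⟨ cong (suc k *_) total ⟩
    suc k * (Ω * φ)         ≡⟨ +-comm (Ω * φ) _ ⟩
    k * (Ω * φ) + Ω * φ     ∎)
  where
  open ≤-Reasoning
  rearrange₁ : ∀ a b c → a * c * b ≡ a * b * c
  rearrange₁ a b c = solve (a ∷ b ∷ c ∷ [])
  Ωφ≤KR : Ω * φ ≤ suc k * R
  Ωφ≤KR = *-cancelʳ-≤ (Ω * φ) (suc k * R) D (begin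
    Ω * φ * D       ≡⟨ rearrange₁ Ω D φ ⟩
    Ω * D * φ       ≤⟨ gain ⟩
    N * R           ≤⟨ *-monoˡ-≤ R N≤KD ⟩
    suc k * D * R   ≡⟨ rearrange₁ (suc k) R D ⟩
    suc k * R * D   ∎)

subsets : ∀ n → List (Subset n)
subsets zero    = Vec.[] ∷ []
subsets (suc n) = map (true Vec.∷_) (subsets n) ++ map (false Vec.∷_) (subsets n)

length-subsets : ∀ n → length (subsets n) ≡ 2 ^ n
length-subsets zero    = refl
length-subsets (suc n) = trans (length-++ (map (true Vec.∷_) (subsets n)))
  (cong₂ _+_ (trans (length-map _ (subsets n)) (length-subsets n))
             (trans (length-map _ (subsets n)) (trans (length-subsets n) (sym (+-identityʳ _)))))

∈-subsets : (S : Subset n) → S ∈ˡ subsets n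
∈-subsets Vec.[]              = here refl
∈-subsets (true  Vec.∷ S) = ∈-++⁺ˡ (∈-map⁺ (true Vec.∷_) (∈-subsets S))
∈-subsets {suc n} (false Vec.∷ S) = ∈-++⁺ʳ (map (true Vec.∷_) (subsets n)) (∈-map⁺ (false Vec.∷_)
  (∈-subsets S))

∑-∈ : {I : Set} {xs : List I} {x : I} (f : I → ℕ) → x ∈ˡ xs → f x ≤ ∑ xs f
∑-∈ {xs = x ∷ xs} f (here refl) = m≤m+n (f x) _
∑-∈ {xs = y ∷ xs} f (there x∈)  = ≤-trans (∑-∈ f x∈) (m≤n+m _ (f y))

∑-mono-⊆ : {p q : Subset n} {f g : Fin n → ℕ} → p ⊆ q → (∀ {x} → x ∈ p → f x ≤ g x) → ∑ (elems p) f ≤ ∑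
  (elems q) g
∑-mono-⊆ {p = p} {q} p⊆q f≤g = ∑-injection _≡_ (λ { refl refl → refl }) (elems-unique p) (elems q)
  λ x∈ → let x∈p = ∈-elems⁻ p x∈ in _ , ∈-elems⁺ (p⊆q x∈p) , refl , f≤g x∈p

∑-∑-const : ∀ m (p q : Subset n) → ∑ (elems p) (λ _ → ∑ (elems q) (λ _ → m)) ≡ ∣ p ∣ * (∣ q ∣ * m)
∑-∑-const m p q = trans (∑-const _ (elems p)) (cong₂ _*_ (length-elems p) (trans (∑-const m (elems q)) (cong
  (_* m) (length-elems q))))

unless : {P : Set} → Dec P → ℕ → ℕ
unless (yes _) m = 0
unless (no  _) m = m

when : {P : Set} → Dec P → ℕ → ℕ
when (yes _) m = m
when (no  _) m = 0

unless+when : {P : Set} (P? : Dec P) (m : ℕ) → unless P? m + when P? m ≡ m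
unless+when (yes _) m = refl
unless+when (no  _) m = +-identityʳ m

when-yes : {P : Set} (P? : Dec P) {m : ℕ} → P → m ≤ when P? m
when-yes (yes _) _ = ≤-refl
when-yes (no ¬p) p = ⊥-elim (¬p p)

Adj : List (Fin n × Fin n) → EdgeRel n
Adj G x y = (x , y) ∈ˡ G

adj? : (G : List (Fin n × Fin n)) → ∀ x y → Dec (Adj G x y)
adj? G x y = Any.any? (λ e → Product.≡-dec Fin._≟_ Fin._≟_ (x , y) e) G

module Exposure {n r s : ℕ} (sampling : Sampling n r) (X Y : Subset n) (X⊥Y : Apart X Y)
                (block : Fin n → Subset n) (x∈block : ∀ {x} → x ∈ X → x ∈ block x)
                (∣block∣ : ∀ {x y} → x ∈ X → y ∈ Y → ∣ block x ∪ ⁅ y ⁆ ∣ ≡ s)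
                (d : ℕ) (0<d : 0 < d) where

  Exposed : List (Subset n) → Set
  Exposed H = Σ (List (Fin n × Fin n)) λ G →
    All (λ (x , y) → x ∈ X × y ∈ Y × block x ∪ ⁅ y ⁆ ∈ˡ H) G

  private
    Large : Subset n × Subset n → Set
    Large (S , T) = S ⊆ X × T ⊆ Y × d ≤ ∣ S ∣ × d ≤ ∣ T ∣

    large? : ∀ p → Dec (Large p)
    large? (S , T) = (S ⊆? X) ×-dec (T ⊆? Y) ×-dec (d ≤? ∣ S ∣) ×-dec (d ≤? ∣ T ∣)

    Hits : Fin n × Fin n → Subset n × Subset n → Set
    Hits (x , y) (S , T) = x ∈ S × y ∈ T

    hits? : ∀ e p → Dec (Hits e p)
    hits? (x , y) (S , T) = (x ∈? S) ×-dec (y ∈? T)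

    -- Indicator of a large pair (S , T) which no exposed edge joins.
    missed : List (Fin n × Fin n) → Subset n × Subset n → ℕ
    missed []      p = when (large? p) 1
    missed (e ∷ G) p = unless (hits? e p) (missed G p)

    pairs : List (Subset n × Subset n)
    pairs = cartesianProduct (subsets n) (subsets n)

    missed-pairs : List (Fin n × Fin n) → ℕ
    missed-pairs G = ∑ pairs (missed G)

    missed-indep : ∀ G {S T} → Large (S , T) → Indep (Adj G) S T → 1 ≤ missed G (S , T)
    missed-indep []      {S} {T} large ind = when-yes (large? (S , T)) large
    missed-indep (e@(x , y) ∷ G) {S} {T} large ind with hits? e (S , T)
    ... | yes (x∈S , y∈T) = ⊥-elim (ind x∈S y∈T (here refl))
    ... | no  _           = missed-indep G large (λ x∈ y∈ xy → ind x∈ y∈ (there xy))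

    missed-small : ∀ G {p} → ¬ Large p → missed G p ≡ 0
    missed-small []      {p} ¬large with large? p
    ... | yes large = ⊥-elim (¬large large)
    ... | no  _     = refl
    missed-small (e ∷ G) {p} ¬large with hits? e p
    ... | yes _ = refl
    ... | no  _ = missed-small G ¬large

    gain : List (Fin n × Fin n) → Subset n × Subset n → Fin n → Fin n → ℕ
    gain G p x y = when (hits? (x , y) p) (missed G p)

    -- An unjoined large pair would be joined by any of the at least `d * d` edges in `S × T`. In
    -- all other cases `missed` is zero.
    gain-total : ∀ G p → d * (d * missed G p) ≤ ∑ (elems X) (λ x → ∑ (elems Y) (gain G p x))
    gain-total G p@(S , T) with large? p
    ... | no ¬large = ≤-trans (≤-reflexive (trans (cong (λ m → d * (d * m)) (missed-small G ¬large))
                        (trans (cong (d *_) (*-zeroʳ d)) (*-zeroʳ d)))) z≤n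
    ... | yes (S⊆X , T⊆Y , d≤S , d≤T) = begin
      d * (d * missed G p)                                    ≤⟨ *-mono-≤ d≤S (*-monoˡ-≤ (missed G p) d≤T) ⟩
      ∣ S ∣ * (∣ T ∣ * missed G p)                            ≡⟨ ∑-∑-const (missed G p) S T ⟨
      ∑ (elems S) (λ _ → ∑ (elems T) (λ _ → missed G p))      ≤⟨ ∑-mono-⊆ S⊆X (λ {x} x∈ → ∑-mono-⊆ T⊆Y
        (λ {y} y∈ → when-yes (hits? (x , y) p) (x∈ , y∈))) ⟩
      ∑ (elems X) (λ x → ∑ (elems Y) (gain G p x))            ∎
      where open ≤-Reasoning

  potential : ∀ {H} → Exposed H → ℕ
  potential (G , _) = missed-pairs G

  potential≡0⇒joined : ∀ {H} (st : Exposed H) → potential st ≡ 0 → Joined (Adj (proj₁ st)) d X Y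
  potential≡0⇒joined (G , _) ≡0 {S} {T} S⊆X T⊆Y d≤S d≤T ind = <-irrefl (sym ≡0)
    (≤-trans (missed-indep G ((λ {x} → S⊆X {x}) , (λ {x} → T⊆Y {x}) , d≤S , d≤T) ind)
             (∑-∈ (missed G) (∈-cartesianProduct⁺ (∈-subsets S) (∈-subsets T))))

  start : ∀ {H} → Exposed H
  start = [] , All.[]

  potential-start : ∀ {H} → potential (start {H}) ≤ 2 ^ n * 2 ^ n
  potential-start = begin
    ∑ pairs (missed [])                     ≤⟨ ∑-mono pairs (λ p → when≤1 (large? p)) ⟩
    ∑ pairs (λ _ → 1)                       ≡⟨ trans (∑-cartesianProduct (subsets n) (subsets n) (λ _ → 1))
      (∑-cong (subsets n) (λ _ → ∑-const 1 (subsets n))) ⟩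
    ∑ (subsets n) (λ _ → length (subsets n) * 1) ≡⟨ ∑-const _ (subsets n) ⟩
    length (subsets n) * (length (subsets n) * 1) ≡⟨ cong₂ _*_ (length-subsets n) (trans (*-identityʳ _)
      (length-subsets n)) ⟩
    2 ^ n * 2 ^ n                           ∎
    where
    open ≤-Reasoning
    when≤1 : {P : Set} (P? : Dec P) → when P? 1 ≤ 1
    when≤1 (yes _) = ≤-refl
    when≤1 (no _)  = z≤n

  -- The weight of an edge is the number of unjoined large pairs that it would join, which is
  -- exactly the drop of the potential. By `gain-total` and `sampling` the expected drop is at least
  -- the fraction `d * d / (n * n)`.
  step : ∀ {k H} → n * n ≤ suc k * (d * d) → (st : Exposed H) → Step r s k Exposed potential st
  step {k} {H} n²≤kd² st@(G , G⊆H) = record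
    { move  = λ O → answer (e O)
    ; next  = λ O → next (e O)
    ; bound = drift {k} {n * n} {d * d} {length (offers n r)} {missed-pairs G} {R = ∑ (offers n r) (λ O →
      reward g (e O))}
                (*-mono-≤ 0<d 0<d) n²≤kd² gained
                (trans (sym (∑-+ (offers n r) _ _)) (trans (∑-cong (offers n r) (λ O → conserved (e O)))
                  (∑-const (missed-pairs G) (offers n r))))
    }
    where
    g : Fin n → Fin n → ℕ
    g x y = ∑ pairs (λ p → gain G p x y)
    sample = sampling X⊥Y g
    e = proj₁ sample
    answer : {O : Offer n r} → Maybe (Pick X Y (proj₁ O)) → Maybe (Edge s O)
    answer nothing = nothing
    answer (just (pick x y x∈X y∈Y O⊆xy)) = just (edge (block x ∪ ⁅ y ⁆)
      (λ z∈O → [ (λ z∈x → p⊆p∪q ⁅ y ⁆ (⁅x⁆⊆p (x∈block x∈X) z∈x)) , q⊆p∪q (block x) ⁅ y ⁆ ]′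
        (x∈p∪q⁻ ⁅ x ⁆ ⁅ y ⁆ (O⊆xy z∈O)))
      (∣block∣ x∈X y∈Y))
    next : {O : Offer n r} (m : Maybe (Pick X Y (proj₁ O))) → Exposed (extend H (answer {O} m))
    next nothing = st
    next (just (pick x y x∈X y∈Y _)) = (x , y) ∷ G , (x∈X , y∈Y , here refl) All.∷ All.map (λ (x∈ , y∈ ,
      xy∈H) → x∈ , y∈ , there xy∈H) G⊆H
    conserved : {O : Offer n r} (m : Maybe (Pick X Y (proj₁ O))) → potential
      (next {O} m) + reward g m ≡ missed-pairs G
    conserved nothing = +-identityʳ _
    conserved (just (pick x y _ _ _)) = trans (sym (∑-+ pairs _ _)) (∑-cong pairs (λ p → unless+when (hits?
      (x , y) p) (missed G p)))
    Ω = length (offers n r)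
    gained : Ω * (d * d) * missed-pairs G ≤ n * n * ∑ (offers n r) (λ O → reward g (e O))
    gained = begin
      Ω * (d * d) * missed-pairs G                                ≡⟨ trans (*-assoc Ω (d * d) _) (cong
        (Ω *_) (*-assoc d d _)) ⟩
      Ω * (d * (d * ∑ pairs (missed G)))                          ≡⟨ cong (Ω *_) (trans (∑-* d pairs _)
        (cong (d *_) (∑-* d pairs (missed G)))) ⟨
      Ω * ∑ pairs (λ p → d * (d * missed G p))                    ≤⟨ *-monoʳ-≤ Ω (∑-mono pairs
        (gain-total G)) ⟩
      Ω * ∑ pairs (λ p → ∑ (elems X) (λ x → ∑ (elems Y) (gain G p x)))
        ≡⟨ cong (Ω *_) (trans (∑-swap pairs (elems X) _) (∑-cong (elems X) (λ x → ∑-swap pairs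
          (elems Y) _))) ⟩
      Ω * ∑ (elems X) (λ x → ∑ (elems Y) (g x))                   ≤⟨ proj₂ sample ⟩
      n * n * ∑ (offers n r) (λ O → reward g (e O))               ∎
      where open ≤-Reasoning

Apart-∪ : {p q r : Subset n} → Apart p r → Apart q r → Apart (p ∪ q) r
Apart-∪ {p = p} {q} p⊥r q⊥r x∈ = [ p⊥r , q⊥r ]′ (x∈p∪q⁻ p q x∈)

Apart-⊆ : {p p′ q q′ : Subset n} → p′ ⊆ p → q′ ⊆ q → Apart p q → Apart p′ q′
Apart-⊆ p′⊆p q′⊆q p⊥q x∈p′ x∈q′ = p⊥q (p′⊆p x∈p′) (q′⊆q x∈q′)

-- Second phase

Disjoint-⋃ : (E : Subset n) (M : List (Subset n)) → Apart E (⋃ M) → All (Disjoint E) M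
Disjoint-⋃ E []      E⊥M = All.[]
Disjoint-⋃ E (F ∷ M) E⊥M = Apart⇒∩≡⊥ (λ x∈E x∈F → E⊥M x∈E (p⊆p∪q (⋃ M) x∈F)) All.∷
                           Disjoint-⋃ E M (λ x∈E x∈M → E⊥M x∈E (q⊆p∪q F (⋃ M) x∈M))

-- 2 ^ K ∸ 1: halved whenever a round succeeds, and zero exactly when no more successes
-- are needed.
pot : ℕ → ℕ
pot zero    = 0
pot (suc K) = pot K + 2 ^ K

pot≤2^ : ∀ K → pot K ≤ 2 ^ K
pot≤2^ zero    = z≤n
pot≤2^ (suc K) = ≤-trans (+-monoˡ-≤ (2 ^ K) (pot≤2^ K)) (≤-reflexive (cong (2 ^ K +_) (sym
  (+-identityʳ _))))

pot≡0 : ∀ K → pot K ≡ 0 → K ≡ 0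
pot≡0 zero    _  = refl
pot≡0 (suc K) eq = ⊥-elim (<-irrefl (sym eq) (≤-trans (m^n>0 2 K) (m≤n+m (2 ^ K) (pot K))))

module Completion {n r t : ℕ} (sampling : Sampling n r) {E : EdgeRel n} (E? : ∀ x y → Dec (E x y))
                  {d : ℕ} (0<d : 0 < d) {X Y : Subset n}
                  (joined : Joined E d X Y) (6d≤X : 6 * d ≤ ∣ X ∣) (6d≤Y : 6 * d ≤ ∣ Y ∣)
                  (core₀ : Core E d X Y)
                  (block : Fin n → Subset n)
                  (block⊥Y : ∀ {x} → x ∈ X → Apart (block x) Y)
                  (block⊥block : ∀ {x x′} → x ∈ X → x′ ∈ X → x ≢ x′ → Apart (block x) (block x′))
                  (∣block∣ : ∀ {x} → x ∈ X → ∣ block x ∣ ≡ 2 + t)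
                  (Y₁ Y₂ : Subset n) (Y₁⊥Y₂ : Apart Y₁ Y₂) where

  open Core core₀

  -- A set as large as the removable sets of `core-removable` has to meet both `Y₁` and `Y₂` often,
  -- so that a random pair from `Y₁ × Y₂` is removable with probability bounded below.
  module _ (rich : ∀ {T} → T ⊆ B → 2 * ∣ A ∣ ≤ ∣ T ∣ + ∣ B ∣ → d ≤ ∣ T ∩ Y₁ ∣ × d ≤ ∣ T ∩ Y₂ ∣) where

    private
      s : ℕ
      s = 3 + t

    -- M is the partial matching chosen so far, Z the vertices outside the core which are
    -- not yet covered, and K the number of further hyperedges of M before the core graph
    -- between A and B′ is matched perfectly.
    record State (H : List (Subset n)) : Set where
      field
        M        : List (Subset n)
        M⊆H      : All (_∈ˡ H) M
        disjoint : AllPairs Disjoint M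
        B′ Z     : Subset n
        K        : ℕ
        B′⊆B     : B′ ⊆ B
        hall     : Hall E A B′
        edges    : ∀ {x y} → E x y → x ∈ A → y ∈ B → block x ∪ ⁅ y ⁆ ∈ˡ H
        B′⊥M     : Apart B′ (⋃ M)
        Z⊥M      : Apart Z (⋃ M)
        Z⊥B′     : Apart Z B′
        block⊥M  : ∀ {x} → x ∈ A → Apart (block x) (⋃ M)
        block⊥Z  : ∀ {x} → x ∈ A → Apart (block x) Z
        -- The `K` further hyperedges use up `s * K` vertices of `B′` and `Z`, leaving exactly
        -- `∣ A ∣`. Each takes a vertex of `Z` while there is one, so `Z≤K` ensures that all of `Z`
        -- is covered.
        balance  : ∣ B′ ∣ + ∣ Z ∣ ≡ ∣ A ∣ + s * K
        Z≤K      : ∣ Z ∣ ≤ K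
        covered  : ∣ ⋃ M ∣ + s * (K + ∣ A ∣) ≡ n

    potential : ∀ {H} → State H → ℕ
    potential st = pot (State.K st)

    -- The hyperedges of the matched core edges join `M` one by one, with disjointness maintained.
    -- Covering follows by counting: the last equation ends as `∣ ⋃ M ∣ ≡ n`.
    complete : ∀ {H} → (∀ {x y} → E x y → x ∈ A → y ∈ B → block x ∪ ⁅ y ⁆ ∈ˡ H) →
               ∀ {A′ B′} → A′ ⊆ A → B′ ⊆ B → Matching E A′ B′ → (M : List (Subset n)) → All (_∈ˡ H) M →
               AllPairs Disjoint M → Apart B′ (⋃ M) → (∀ {x} → x ∈ A′ → Apart (block x) (⋃ M)) →
               ∣ ⋃ M ∣ + s * ∣ A′ ∣ ≡ n → HasPerfectMatching H
    complete edges A′⊆A B′⊆B (done A′≡0) M M⊆H disjoint B′⊥M block⊥M covered =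
      M , M⊆H , disjoint , ∣p∣≡n⇒p≡⊤ (trans (trans (sym (+-identityʳ _)) (cong (∣ ⋃ M ∣ +_) (sym (trans
        (cong (s *_) A′≡0) (*-zeroʳ s))))) covered)
    complete edges {A′} {B′} A′⊆A B′⊆B
      (pair {x = x} {y} x∈A′ y∈B′ xy m) M M⊆H disjoint B′⊥M block⊥M covered =
      complete edges (λ z∈ → A′⊆A (p─q⊆p A′ ⁅ x ⁆ z∈)) (λ z∈ → B′⊆B (p─q⊆p B′ ⁅ y ⁆ z∈)) m (F ∷ M)
        (edges xy x∈A y∈B All.∷ M⊆H) (Disjoint-⋃ F M F⊥M AllPairs.∷ disjoint)
        (λ z∈ → [ (λ z∈F → [ (λ z∈x → block⊥Y x∈X z∈x (B⊆Y (B′⊆B (p─q⊆p B′ ⁅ y ⁆ z∈)))) ,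
          x∈p─q⇒x∉q B′ ⁅ y ⁆ z∈ ]′ (x∈p∪q⁻ (block x) ⁅ y ⁆ z∈F))
                , B′⊥M (p─q⊆p B′ ⁅ y ⁆ z∈) ]′ ∘ x∈p∪q⁻ F (⋃ M))
        (λ {x′} x′∈ z∈ → let x′∈A′ = p─q⊆p A′ ⁅ x ⁆ x′∈ in
          [ (λ z∈F → [ block⊥block (A⊆X (A′⊆A x′∈A′)) x∈X (λ { refl → x∉p-x A′ x x′∈ }) z∈
                     , (λ z∈y → block⊥Y (A⊆X (A′⊆A x′∈A′)) z∈ (⁅x⁆⊆p (B⊆Y y∈B) z∈y)) ]′ (x∈p∪q⁻
                       (block x) ⁅ y ⁆ z∈F))
          , block⊥M x′∈A′ z∈ ]′ ∘ x∈p∪q⁻ F (⋃ M))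
        (trans (trans (cong (_+ s * ∣ A′ - x ∣) (trans (∣p∪q∣≡∣p∣+∣q∣ F⊥M) (cong (_+ ∣ ⋃ M ∣) ∣F∣)))
          (arith (∣ ⋃ M ∣) s (∣ A′ - x ∣))) (trans (cong (λ a → ∣ ⋃ M ∣ + s * a)
            (∣p-x∣+1≡∣p∣ x∈A′)) covered))
      where
      F = block x ∪ ⁅ y ⁆
      x∈A = A′⊆A x∈A′
      x∈X = A⊆X x∈A
      y∈B = B′⊆B y∈B′
      F⊥M : Apart F (⋃ M)
      F⊥M = Apart-∪ (block⊥M x∈A′) (λ z∈y → B′⊥M (⁅x⁆⊆p y∈B′ z∈y))
      ∣F∣ : ∣ F ∣ ≡ s
      ∣F∣ = trans (∣p∪q∣≡∣p∣+∣q∣ (λ z∈x z∈y → block⊥Y x∈X z∈x (⁅x⁆⊆p (B⊆Y y∈B) z∈y)))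
        (trans (cong₂ _+_ (∣block∣ x∈X) (∣⁅x⁆∣≡1 y)) (+-comm (2 + t) 1))
      arith : ∀ m s a → s + m + s * a ≡ m + s * suc a
      arith m s a = solve (m ∷ s ∷ a ∷ [])

    finish : ∀ {H} (st : State H) → potential st ≡ 0 → HasPerfectMatching H
    finish st pot≡ with State.K st in eq
    ... | suc K = ⊥-elim (1+n≢0 (pot≡0 (suc K) pot≡))
    ... | zero  = complete edges (λ x∈ → x∈) B′⊆B (hall⇒matching E?
      (∣ A ∣) refl hall) M M⊆H disjoint B′⊥M block⊥M
      (subst (λ K → ∣ ⋃ M ∣ + s * (K + ∣ A ∣) ≡ n) eq covered)
      where open State st

    removable-rich : ∀ {B′} → B′ ⊆ B → ∣ A ∣ < ∣ B′ ∣ → Hall E A B′ →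
      Σ (Subset n) λ T → T ⊆ B′ × (∀ {y} → y ∈ T → Hall E A (B′ - y)) × d ≤ ∣ T ∩ Y₁ ∣ × d ≤ ∣ T ∩ Y₂ ∣
    removable-rich {B′} B′⊆B A<B′ hall with core-removable E? joined 6d≤X 6d≤Y core₀ B′⊆B A<B′ hall
    ... | T , T⊆B′ , large , rem = T , (λ {x} → T⊆B′ {x}) , rem ,
      rich (λ x∈ → B′⊆B (T⊆B′ x∈)) (≤-trans (*-monoʳ-≤ 2 (<⇒≤ A<B′)) large)

    -- Supplies the vertices of a hyperedge that the player takes from `B′` freely. Removable
    -- vertices are deleted one at a time; since `0 < d`, the set `T ∩ Y₁` always contains one.
    fill : ∀ f {B′} → B′ ⊆ B → ∣ A ∣ + f ≤ ∣ B′ ∣ → Hall E A B′ →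
           Σ (Subset n) λ F → F ⊆ B′ × ∣ F ∣ ≡ f × Hall E A (B′ ─ F)
    fill zero    {B′} B′⊆B A≤B′ hall = ⊥ , ⊥⊆ , ∣⊥∣≡0 n , subst (Hall E A) (sym (p─⊥≡p B′)) hall
    fill (suc f) {B′} B′⊆B A≤B′ hall = ⁅ y ⁆ ∪ F , ∪-⊆ (⁅x⁆⊆p y∈B′) (λ x∈ → p─q⊆p B′ ⁅ y ⁆ (F⊆ x∈)) ,
      trans (∣p∪q∣≡∣p∣+∣q∣ (λ x∈y x∈F → x∈p─q⇒x∉q B′ ⁅ y ⁆ (F⊆ x∈F) x∈y)) (cong₂ _+_ (∣⁅x⁆∣≡1 y) ∣F∣) ,
      subst (Hall E A) (p─q─r≡p─q∪r B′ ⁅ y ⁆ F) hall′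
      where
      A<B′ : suc (∣ A ∣ + f) ≤ ∣ B′ ∣
      A<B′ = ≤-trans (≤-reflexive (sym (+-suc (∣ A ∣) f))) A≤B′
      R = removable-rich B′⊆B (≤-trans (s≤s (m≤m+n (∣ A ∣) f)) A<B′) hall
      T = proj₁ R
      T∩Y₁≠∅ : Nonempty (T ∩ Y₁)
      T∩Y₁≠∅ = ∣p∣>0⇒nonempty (T ∩ Y₁) (≤-trans 0<d (proj₁ (proj₂ (proj₂ (proj₂ R)))))
      y = proj₁ T∩Y₁≠∅
      y∈T = p∩q⊆p T Y₁ (proj₂ T∩Y₁≠∅)
      y∈B′ : y ∈ B′
      y∈B′ = proj₁ (proj₂ R) y∈T
      rec = fill f {B′ - y} (λ x∈ → B′⊆B (p─q⊆p B′ ⁅ y ⁆ x∈))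
        (s≤s⁻¹ (≤-trans A<B′ (≤-reflexive (sym (∣p-x∣+1≡∣p∣ y∈B′))))) (proj₁ (proj₂ (proj₂ R)) y∈T)
      F = proj₁ rec
      F⊆ : F ⊆ B′ - y
      F⊆ = proj₁ (proj₂ rec)
      ∣F∣ = proj₁ (proj₂ (proj₂ rec))
      hall′ = proj₂ (proj₂ (proj₂ rec))

    module Round {H : List (Subset n)} (st : State H) (K′ : ℕ) (K≡ : State.K st ≡ suc K′) where
      open State st

      private
        balance′ : ∣ B′ ∣ + ∣ Z ∣ ≡ ∣ A ∣ + s * suc K′
        balance′ = subst (λ K → ∣ B′ ∣ + ∣ Z ∣ ≡ ∣ A ∣ + s * K) K≡ balance

        Z≤K′ : ∣ Z ∣ ≤ suc K′
        Z≤K′ = subst (∣ Z ∣ ≤_) K≡ Z≤K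

        roomy : ∀ a t b z k → a + (3 + t) * suc k ≤ b + z → z ≤ suc k → a + t + 2 ≤ b
        roomy a t b z k p q = linear (t * k + 2 * k) (+-mono-≤ p q) (solve (a ∷ t ∷ b ∷ z ∷ k ∷ []))

        roomy₀ : ∀ a t b k → a + (3 + t) * suc k ≤ b + 0 → a + suc t + 2 ≤ b
        roomy₀ a t b k p = linear (t * k + 3 * k) p (solve (a ∷ t ∷ b ∷ k ∷ []))

        -- Besides the random pair, the next hyperedge has `s - 2 = 1 + t` vertices: one from `Z` if
        -- possible, the remaining `f` from `B′`. The summand 2 in the last inequality reserves room
        -- for the pair.
        chunk : Σ (Subset n) λ Q → Σ ℕ λ f →
          Q ⊆ Z × ∣ Q ∣ + f ≡ suc t × ∣ Z ─ Q ∣ ≤ K′ × ∣ A ∣ + f + 2 ≤ ∣ B′ ∣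
        chunk with nonempty? Z
        ... | yes (z , z∈Z) = ⁅ z ⁆ , t , ⁅x⁆⊆p z∈Z , cong (_+ t) (∣⁅x⁆∣≡1 z) ,
          s≤s⁻¹ (≤-trans (≤-reflexive (∣p-x∣+1≡∣p∣ z∈Z)) Z≤K′) ,
          roomy (∣ A ∣) t (∣ B′ ∣) (∣ Z ∣) K′ (≤-reflexive (sym balance′)) Z≤K′
        ... | no ¬ne = ⊥ , suc t , ⊥⊆ , cong (_+ suc t) (∣⊥∣≡0 n) ,
          ≤-trans (≤-reflexive (trans (cong ∣_∣ (p─⊥≡p Z)) Z≡0)) z≤n ,
          roomy₀ (∣ A ∣) t (∣ B′ ∣) K′ (≤-reflexive (sym (subst (λ z →
            ∣ B′ ∣ + z ≡ ∣ A ∣ + s * suc K′) Z≡0 balance′)))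
          where
          Z≡0 : ∣ Z ∣ ≡ 0
          Z≡0 = trans (cong ∣_∣ (Empty-unique ¬ne)) (∣⊥∣≡0 n)

        Q = proj₁ chunk
        f = proj₁ (proj₂ chunk)
        Q⊆Z : Q ⊆ Z
        Q⊆Z = proj₁ (proj₂ (proj₂ chunk))
        ∣Q∣+f = proj₁ (proj₂ (proj₂ (proj₂ chunk)))
        Z─Q≤K′ = proj₁ (proj₂ (proj₂ (proj₂ (proj₂ chunk))))
        room = proj₂ (proj₂ (proj₂ (proj₂ (proj₂ chunk))))

        filler = fill f B′⊆B (m+n≤o⇒m≤o (∣ A ∣ + f) room) hall
        F = proj₁ filler
        F⊆B′ : F ⊆ B′
        F⊆B′ = proj₁ (proj₂ filler)
        ∣F∣ = proj₁ (proj₂ (proj₂ filler))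

        B₁ : Subset n
        B₁ = B′ ─ F
        B₁⊆B′ : B₁ ⊆ B′
        B₁⊆B′ = p─q⊆p B′ F
        ∣B₁∣ : ∣ B₁ ∣ + f ≡ ∣ B′ ∣
        ∣B₁∣ = trans (cong (∣ B₁ ∣ +_) (sym ∣F∣)) (∣p─q∣+∣q∣≡∣p∣ F⊆B′)
        A+2≤B₁ : 2 + ∣ A ∣ ≤ ∣ B₁ ∣
        A+2≤B₁ = arith (∣ A ∣) f (∣ B₁ ∣) (≤-trans room (≤-reflexive (sym ∣B₁∣)))
          where
          arith : ∀ a f b → a + f + 2 ≤ b + f → 2 + a ≤ b
          arith a f b p = linear 0 p (solve (a ∷ f ∷ b ∷ []))

        R₁ = removable-rich (λ x∈ → B′⊆B (B₁⊆B′ x∈)) (<⇒≤ A+2≤B₁) (proj₂ (proj₂ (proj₂ filler)))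
        T₁ = proj₁ R₁
        T₁⊆B₁ : T₁ ⊆ B₁
        T₁⊆B₁ = proj₁ (proj₂ R₁)

        R₂ : ∀ {a} → a ∈ T₁ → _
        R₂ {a} a∈T₁ = removable-rich {B₁ - a} (λ x∈ → B′⊆B (B₁⊆B′ (p─q⊆p B₁ ⁅ a ⁆ x∈)))
          (s≤s⁻¹ (≤-trans A+2≤B₁ (≤-reflexive (sym (∣p-x∣+1≡∣p∣ (T₁⊆B₁ a∈T₁))))))
          (proj₁ (proj₂ (proj₂ R₁)) a∈T₁)
        T₂ : ∀ {a} → a ∈ T₁ → Subset n
        T₂ a∈T₁ = proj₁ (R₂ a∈T₁)
        T₂⊆ : ∀ {a} (a∈T₁ : a ∈ T₁) → T₂ a∈T₁ ⊆ B₁ - a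
        T₂⊆ a∈T₁ = proj₁ (proj₂ (R₂ a∈T₁))

        Accepted : Fin n → Fin n → Set
        Accepted a b = Σ (a ∈ T₁) λ a∈ → b ∈ T₂ a∈

        -- The pair is removed one vertex at a time, so b is judged after a is gone.
        verdict₂ : ∀ {a b} (a∈ : a ∈ T₁) → Dec (b ∈ T₂ a∈) → Maybe (Accepted a b)
        verdict₂ a∈ (no _)   = nothing
        verdict₂ a∈ (yes b∈) = just (a∈ , b∈)

        verdict₁ : ∀ {a} b → Dec (a ∈ T₁) → Maybe (Accepted a b)
        verdict₁ b (no _)   = nothing
        verdict₁ b (yes a∈) = verdict₂ a∈ (b ∈? T₂ a∈)

        verdict : ∀ a b → Maybe (Accepted a b)
        verdict a b = verdict₁ b (a ∈? T₁)

        -- Accepting a pair lowers the potential from `pot (suc K′)` to `pot K′`, that is, by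
        -- `2 ^ K′`.
        value : ∀ {a b} → Maybe (Accepted a b) → ℕ
        value nothing  = 0
        value (just _) = 2 ^ K′

        g : Fin n → Fin n → ℕ
        g a b = value (verdict a b)

        value-row : ∀ {a} (a∈? : Dec (a ∈ T₁)) → a ∈ T₁ → d * 2 ^ K′ ≤ ∑ (elems Y₂) (λ b → value
          (verdict₁ b a∈?))
        value-row (no a∉)  a∈ = ⊥-elim (a∉ a∈)
        value-row (yes a∈) _  = begin
          d * 2 ^ K′                              ≤⟨ *-monoˡ-≤ (2 ^ K′) (proj₂ (proj₂ (proj₂ (proj₂
            (R₂ a∈))))) ⟩
          ∣ T₂ a∈ ∩ Y₂ ∣ * 2 ^ K′                 ≡⟨ trans (∑-const _ (elems (T₂ a∈ ∩ Y₂))) (cong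
            (_* 2 ^ K′) (length-elems (T₂ a∈ ∩ Y₂))) ⟨
          ∑ (elems (T₂ a∈ ∩ Y₂)) (λ _ → 2 ^ K′)   ≤⟨ ∑-mono-⊆ (p∩q⊆q (T₂ a∈) Y₂) (λ {b} b∈ → accepted
            (b ∈? T₂ a∈) (p∩q⊆p (T₂ a∈) Y₂ b∈)) ⟩
          ∑ (elems Y₂) (λ b → value (verdict₂ a∈ (b ∈? T₂ a∈))) ∎
          where
          open ≤-Reasoning
          accepted : ∀ {b} (b∈? : Dec (b ∈ T₂ a∈)) → b ∈ T₂ a∈ → 2 ^ K′ ≤ value (verdict₂ a∈ b∈?)
          accepted (yes _) _  = ≤-refl
          accepted (no b∉) b∈ = ⊥-elim (b∉ b∈)

        value-total : d * (d * 2 ^ K′) ≤ ∑ (elems Y₁) (λ a → ∑ (elems Y₂) (g a))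
        value-total = begin
          d * (d * 2 ^ K′)                                ≤⟨ *-monoˡ-≤ (d * 2 ^ K′) (proj₁ (proj₂ (proj₂
            (proj₂ R₁)))) ⟩
          ∣ T₁ ∩ Y₁ ∣ * (d * 2 ^ K′)                      ≡⟨ trans (∑-const _ (elems (T₁ ∩ Y₁))) (cong (_*
            (d * 2 ^ K′)) (length-elems (T₁ ∩ Y₁))) ⟨
          ∑ (elems (T₁ ∩ Y₁)) (λ _ → d * 2 ^ K′)          ≤⟨ ∑-mono-⊆ (p∩q⊆q T₁ Y₁) (λ {a} a∈ → value-row
            (a ∈? T₁) (p∩q⊆p T₁ Y₁ a∈)) ⟩
          ∑ (elems Y₁) (λ a → ∑ (elems Y₂) (g a))         ∎
          where open ≤-Reasoning

        module _ {a b : Fin n} (acc : Accepted a b) where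
          a∈B₁ : a ∈ B₁
          a∈B₁ = T₁⊆B₁ (proj₁ acc)
          b∈B₁-a : b ∈ B₁ - a
          b∈B₁-a = T₂⊆ (proj₁ acc) (proj₂ acc)
          b∈B₁ : b ∈ B₁
          b∈B₁ = p─q⊆p B₁ ⁅ a ⁆ b∈B₁-a
          D N B₂ : Subset n
          D = ⁅ a ⁆ ∪ ⁅ b ⁆
          N = (Q ∪ F) ∪ D
          B₂ = B₁ - a - b
          D⊆B₁ : D ⊆ B₁
          D⊆B₁ = ∪-⊆ (⁅x⁆⊆p a∈B₁) (⁅x⁆⊆p b∈B₁)
          D⊆B′ : D ⊆ B′
          D⊆B′ x∈ = B₁⊆B′ (D⊆B₁ x∈)
          B₂⊆B₁ : B₂ ⊆ B₁
          B₂⊆B₁ x∈ = p─q⊆p B₁ ⁅ a ⁆ (p─q⊆p (B₁ - a) ⁅ b ⁆ x∈)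
          B₂⊆B′ : B₂ ⊆ B′
          B₂⊆B′ x∈ = B₁⊆B′ (B₂⊆B₁ x∈)
          B′⊆Y : B′ ⊆ Y
          B′⊆Y x∈ = B⊆Y (B′⊆B x∈)

          N⊥ : ∀ {p} → Apart Q p → Apart F p → Apart D p → Apart N p
          N⊥ Q⊥p F⊥p D⊥p = Apart-∪ (Apart-∪ Q⊥p F⊥p) D⊥p

          Q⊥B′ : Apart Q B′
          Q⊥B′ x∈ = Z⊥B′ (Q⊆Z x∈)

          ∣D∣ : ∣ D ∣ ≡ 2
          ∣D∣ = trans (∣p∪q∣≡∣p∣+∣q∣ a⊥b) (cong₂ _+_ (∣⁅x⁆∣≡1 a) (∣⁅x⁆∣≡1 b))
            where
            a⊥b : Apart ⁅ a ⁆ ⁅ b ⁆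
            a⊥b x∈a x∈b = x∈p─q⇒x∉q B₁ ⁅ a ⁆ (⁅x⁆⊆p b∈B₁-a x∈b) x∈a

          ∣N∣ : ∣ N ∣ ≡ s
          ∣N∣ = begin
            ∣ N ∣                    ≡⟨ ∣p∪q∣≡∣p∣+∣q∣ (Apart-∪ (λ x∈Q x∈D → Q⊥B′ x∈Q (D⊆B′ x∈D))
              (λ x∈F x∈D → x∈p─q⇒x∉q B′ F (D⊆B₁ x∈D) x∈F)) ⟩
            ∣ Q ∪ F ∣ + ∣ D ∣        ≡⟨ cong₂ _+_ (∣p∪q∣≡∣p∣+∣q∣ (λ x∈Q x∈F → Q⊥B′ x∈Q (F⊆B′ x∈F))) ∣D∣ ⟩
            ∣ Q ∣ + ∣ F ∣ + 2        ≡⟨ cong (_+ 2) (trans (cong (∣ Q ∣ +_) ∣F∣) ∣Q∣+f) ⟩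
            suc t + 2                ≡⟨ +-comm (suc t) 2 ⟩
            s                        ∎
            where open ≡-Reasoning

          N⊥M : Apart N (⋃ M)
          N⊥M = N⊥ (λ x∈ → Z⊥M (Q⊆Z x∈)) (λ x∈ → B′⊥M (F⊆B′ x∈)) (λ x∈ → B′⊥M (D⊆B′ x∈))

          advance : State (N ∷ H)
          advance = record
            { M        = N ∷ M
            ; M⊆H      = here refl All.∷ All.map there M⊆H
            ; disjoint = Disjoint-⋃ N M N⊥M AllPairs.∷ disjoint
            ; B′       = B₂
            ; Z        = Z ─ Q
            ; K        = K′
            ; B′⊆B     = λ x∈ → B′⊆B (B₂⊆B′ x∈)
            ; hall     = proj₁ (proj₂ (proj₂ (R₂ (proj₁ acc)))) (proj₂ acc)
            ; edges    = λ xy x∈ y∈ → there (edges xy x∈ y∈)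
            ; B′⊥M     = Apart-sym (Apart-∪ (N⊥ (λ x∈Q x∈B₂ → Q⊥B′ x∈Q (B₂⊆B′ x∈B₂))
                                             (λ x∈F x∈B₂ → x∈p─q⇒x∉q B′ F (B₂⊆B₁ x∈B₂) x∈F)
                                             (Apart-∪ (λ x∈a x∈B₂ → x∈p─q⇒x∉q B₁ ⁅ a ⁆ (p─q⊆p
                                               (B₁ - a) ⁅ b ⁆ x∈B₂) x∈a)
                                                      (λ x∈b x∈B₂ → x∈p─q⇒x∉q (B₁ - a) ⁅ b ⁆ x∈B₂ x∈b)))
                                           (λ x∈M x∈B₂ → B′⊥M (B₂⊆B′ x∈B₂) x∈M))
            ; Z⊥M      = Apart-sym (Apart-∪ (N⊥ (λ x∈Q x∈Z─Q → x∈p─q⇒x∉q Z Q x∈Z─Q x∈Q)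
                                             (λ x∈F x∈Z─Q → Z⊥B′ (p─q⊆p Z Q x∈Z─Q) (F⊆B′ x∈F))
                                             (λ x∈D x∈Z─Q → Z⊥B′ (p─q⊆p Z Q x∈Z─Q) (D⊆B′ x∈D)))
                                           (λ x∈M x∈Z─Q → Z⊥M (p─q⊆p Z Q x∈Z─Q) x∈M))
            ; Z⊥B′     = Apart-⊆ (p─q⊆p Z Q) B₂⊆B′ Z⊥B′
            ; block⊥M  = λ x∈A → Apart-sym (Apart-∪ (N⊥ (λ x∈Q x∈bl → block⊥Z x∈A x∈bl (Q⊆Z x∈Q))
                                             (λ x∈F x∈bl → block⊥Y (A⊆X x∈A) x∈bl (B′⊆Y (F⊆B′ x∈F)))
                                             (λ x∈D x∈bl → block⊥Y (A⊆X x∈A) x∈bl (B′⊆Y (D⊆B′ x∈D))))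
                                           (λ x∈M x∈bl → block⊥M x∈A x∈bl x∈M))
            ; block⊥Z  = λ x∈A → Apart-⊆ (λ x∈ → x∈) (p─q⊆p Z Q) (block⊥Z x∈A)
            ; balance  = balance″ (∣ B₂ ∣) (∣ Z ─ Q ∣) (∣ Q ∣) f (∣ A ∣) (∣ B′ ∣) (∣ Z ∣) K′
                           (trans (cong (_+ f) (trans (cong suc (∣p-x∣+1≡∣p∣ b∈B₁-a))
                             (∣p-x∣+1≡∣p∣ a∈B₁))) ∣B₁∣)
                           (∣p─q∣+∣q∣≡∣p∣ Q⊆Z) ∣Q∣+f balance′
            ; Z≤K      = Z─Q≤K′
            ; covered  = trans (trans (cong (_+ s * (K′ + ∣ A ∣)) (trans (∣p∪q∣≡∣p∣+∣q∣ N⊥M) (cong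
              (_+ ∣ ⋃ M ∣) ∣N∣)))
                           (regroup s (∣ ⋃ M ∣) K′ (∣ A ∣))) (subst (λ K → ∣ ⋃ M ∣ + s *
                             (K + ∣ A ∣) ≡ n) K≡ covered)
            }
            where
            regroup : ∀ s m k a → s + m + s * (k + a) ≡ m + s * (suc k + a)
            regroup s m k a = solve (s ∷ m ∷ k ∷ a ∷ [])
            balance″ : ∀ b₂ z₂ q f a b z k → suc (suc b₂) + f ≡ b → z₂ + q ≡ z → q + f ≡ suc t →
                       b + z ≡ a + (3 + t) * suc k → b₂ + z₂ ≡ a + (3 + t) * k
            balance″ b₂ z₂ q f a b z k refl refl q+f eq = +-cancelʳ-≡ (2 + (q + f)) (b₂ + z₂) (a +
              (3 + t) * k)
              (trans (rearrange₁ b₂ z₂ q f) (trans eq (trans (rearrange₂ a t k) (cong (λ u → a +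
                (3 + t) * k + (2 + u)) (sym q+f)))))
              where
              rearrange₁ : ∀ b₂ z₂ q f → b₂ + z₂ + (2 + (q + f)) ≡ suc (suc b₂) + f + (z₂ + q)
              rearrange₁ b₂ z₂ q f = solve (b₂ ∷ z₂ ∷ q ∷ f ∷ [])
              rearrange₂ : ∀ a t k → a + (3 + t) * suc k ≡ a + (3 + t) * k + (2 + suc t)
              rearrange₂ a t k = solve (a ∷ t ∷ k ∷ [])

        sample = sampling Y₁⊥Y₂ g
        e = proj₁ sample

        answer′ : {O : Offer n r} {a b : Fin n} → proj₁ O ⊆ ⁅ a ⁆ ∪ ⁅ b ⁆ → Maybe (Accepted a b) → Maybe
          (Edge s O)
        answer′ O⊆ nothing    = nothing
        answer′ O⊆ (just acc) = just (edge (N acc) (λ x∈ → q⊆p∪q (Q ∪ F) (D acc) (O⊆ x∈)) (∣N∣ acc))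

        answer : {O : Offer n r} → Maybe (Pick Y₁ Y₂ (proj₁ O)) → Maybe (Edge s O)
        answer nothing                    = nothing
        answer (just (pick a b _ _ O⊆ab)) = answer′ O⊆ab (verdict a b)

        next′ : {O : Offer n r} {a b : Fin n} (O⊆ : proj₁ O ⊆ ⁅ a ⁆ ∪ ⁅ b ⁆) (v : Maybe (Accepted a b)) →
                State (extend H (answer′ {O} O⊆ v))
        next′ O⊆ nothing    = st
        next′ O⊆ (just acc) = advance acc

        next : {O : Offer n r} (m : Maybe (Pick Y₁ Y₂ (proj₁ O))) → State (extend H (answer {O} m))
        next nothing                        = st
        next {O} (just (pick a b _ _ O⊆ab)) = next′ {O} O⊆ab (verdict a b)

        potential-st : pot K + 0 ≡ pot (suc K′)
        potential-st = trans (+-identityʳ (pot K)) (cong pot K≡)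

        conserved′ : {O : Offer n r} {a b : Fin n} (O⊆ : proj₁ O ⊆ ⁅ a ⁆ ∪ ⁅ b ⁆) (v : Maybe
          (Accepted a b)) →
                     potential (next′ {O} O⊆ v) + value v ≡ pot (suc K′)
        conserved′ O⊆ nothing    = potential-st
        conserved′ O⊆ (just acc) = refl

        conserved : {O : Offer n r} (m : Maybe (Pick Y₁ Y₂ (proj₁ O))) → potential
          (next {O} m) + reward g m ≡ pot (suc K′)
        conserved nothing                        = potential-st
        conserved {O} (just (pick a b _ _ O⊆ab)) = conserved′ {O} O⊆ab (verdict a b)

        Ω = length (offers n r)

        gained : Ω * (d * d) * pot (suc K′) ≤ 2 * (n * n) * ∑ (offers n r) (λ O → reward g (e O))
        gained = begin
          -- The drop `2 ^ K′` is at least half of the potential; hence the factor 2 in front of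
          -- `n * n`.
          Ω * (d * d) * (pot K′ + 2 ^ K′)                       ≤⟨ *-monoʳ-≤ (Ω * (d * d)) (+-monoˡ-≤
            (2 ^ K′) (pot≤2^ K′)) ⟩
          Ω * (d * d) * (2 ^ K′ + 2 ^ K′)                       ≡⟨ rearrange Ω d (2 ^ K′) ⟩
          2 * (Ω * (d * (d * 2 ^ K′)))                          ≤⟨ *-monoʳ-≤ 2 (*-monoʳ-≤ Ω value-total) ⟩
          2 * (Ω * ∑ (elems Y₁) (λ a → ∑ (elems Y₂) (g a)))     ≤⟨ *-monoʳ-≤ 2 (proj₂ sample) ⟩
          2 * (n * n * ∑ (offers n r) (λ O → reward g (e O)))   ≡⟨ *-assoc 2 (n * n) _ ⟨
          2 * (n * n) * ∑ (offers n r) (λ O → reward g (e O))   ∎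
          where
          open ≤-Reasoning
          rearrange : ∀ w d p → w * (d * d) * (p + p) ≡ 2 * (w * (d * (d * p)))
          rearrange w d p = solve (w ∷ d ∷ p ∷ [])

      step : ∀ {k} → 2 * (n * n) ≤ suc k * (d * d) → Step r s k State potential st
      step {k} 2n²≤kd² = record
        { move  = λ O → answer (e O)
        ; next  = λ O → next (e O)
        ; bound = subst (λ K → suc k * ∑ (offers n r) (λ O → potential (next (e O))) ≤ k * (Ω * pot K))
          (sym K≡)
            (drift {k} {2 * (n * n)} {d * d} {Ω} {pot (suc K′)} {R = ∑ (offers n r) (λ O → reward g (e O))}
              (*-mono-≤ 0<d 0<d) 2n²≤kd² gained
              (trans (sym (∑-+ (offers n r) _ _)) (trans (∑-cong (offers n r) (λ O → conserved (e O)))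
                (∑-const (pot (suc K′)) (offers n r)))))
        }

    step : ∀ {k H} → 2 * (n * n) ≤ suc k * (d * d) → (st : State H) → 0 < potential st →
      Step r s k State potential st
    step 2n²≤kd² st 0<pot with State.K st in eq
    ... | zero   = ⊥-elim (n≮0 0<pot)
    ... | suc K′ = Round.step st K′ eq 2n²≤kd²

-- Laying out the blocks

record Layout (n w p : ℕ) : Set where
  field
    X Y         : Subset n
    block       : Fin n → Subset n
    x∈block     : ∀ {x} → x ∈ X → x ∈ block x
    ∣block∣     : ∀ {x} → x ∈ X → ∣ block x ∣ ≡ w
    block⊥Y     : ∀ {x} → x ∈ X → Apart (block x) Y
    block⊥block : ∀ {x x′} → x ∈ X → x′ ∈ X → x ≢ x′ → Apart (block x) (block x′)
    ∣X∣         : ∣ X ∣ ≡ p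
    ∣Y∣         : ∣ Y ∣ + w * p ≡ n

private
  Blocks : Subset n → ℕ → ℕ → Set
  Blocks {n} R w p = Σ (Subset n) λ X → Σ (Fin n → Subset n) λ block → ∣ X ∣ ≡ p ×
    (∀ {x} → x ∈ X → x ∈ block x × block x ⊆ R × ∣ block x ∣ ≡ w) ×
    (∀ {x x′} → x ∈ X → x′ ∈ X → x ≢ x′ → Apart (block x) (block x′))

  -- A block `Q` is cut out of `R` and one of its vertices represents it in `X`. The other blocks
  -- lie in `R ─ Q` and are therefore disjoint from it.
  blocks : ∀ w p (R : Subset n) → ∣ R ∣ ≡ suc w * p → Blocks R (suc w) p
  blocks {n} w zero    R ∣R∣ = ⊥ , (λ _ → ⊥) , ∣⊥∣≡0 n , (λ x∈ → ⊥-elim (∉⊥ x∈)) , λ x∈ → ⊥-elim (∉⊥ x∈)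
  blocks {n} w (suc p) R ∣R∣
    with Q , Q⊆R , ∣Q∣ ← subset-of-size R (suc w) (≤-trans (m≤m*n (suc w) (suc p)) (≤-reflexive (sym ∣R∣)))
    with x , x∈Q ← ∣p∣>0⇒nonempty Q (subst (0 <_) (sym ∣Q∣) z<s)
    with X , block , ∣X∣ , props , apart ← blocks w p (R ─ Q) (+-cancelʳ-≡ (suc w) (∣ R ─ Q ∣) (suc w * p)
           (trans (trans (cong (∣ R ─ Q ∣ +_) (sym ∣Q∣)) (trans (∣p─q∣+∣q∣≡∣p∣ Q⊆R) ∣R∣)) (trans (*-suc
             (suc w) p) (+-comm (suc w) _))))
    = X ∪ ⁅ x ⁆ , block′ , trans (∣p∪q∣≡∣p∣+∣q∣ X⊥x) (trans (cong₂ _+_ ∣X∣ (∣⁅x⁆∣≡1 x)) (+-comm p 1)) ,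
      (λ z∈ → props′ (cases z∈)) , λ z∈ z′∈ → apart′ (cases z∈) (cases z′∈)
    where
    X⊆R─Q : X ⊆ R ─ Q
    X⊆R─Q z∈ = proj₁ (proj₂ (props z∈)) (proj₁ (props z∈))
    X⊥x : Apart X ⁅ x ⁆
    X⊥x z∈X z∈x = x∈p─q⇒x∉q R Q (X⊆R─Q z∈X) (⁅x⁆⊆p x∈Q z∈x)
    block′ : Fin n → Subset n
    block′ z with z Fin.≟ x
    ... | yes _ = Q
    ... | no  _ = block z
    Case : Fin n → Set
    Case z = (z ≡ x × block′ z ≡ Q) ⊎ (z ∈ X × block′ z ≡ block z)
    cases : ∀ {z} → z ∈ X ∪ ⁅ x ⁆ → Case z
    cases {z} z∈ with z Fin.≟ x
    ... | yes z≡x = inj₁ (z≡x , refl)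
    ... | no  z≢x = inj₂ ([ (λ z∈X → z∈X) , (λ z∈x → ⊥-elim (z≢x (x∈⁅y⁆⇒x≡y x z∈x))) ]′
      (x∈p∪q⁻ X ⁅ x ⁆ z∈) , refl)
    props′ : ∀ {z} → Case z → z ∈ block′ z × block′ z ⊆ R × ∣ block′ z ∣ ≡ suc w
    props′ (inj₁ (refl , eq)) = subst (x ∈_) (sym eq) x∈Q , (λ y∈ → Q⊆R (subst (_ ∈_) eq y∈)) , trans
      (cong ∣_∣ eq) ∣Q∣
    props′ {z} (inj₂ (z∈X , eq)) = let (z∈ , ⊆R─Q , size) = props z∈X in
      subst (z ∈_) (sym eq) z∈ , (λ y∈ → p─q⊆p R Q (⊆R─Q (subst (_ ∈_) eq y∈))) , trans (cong ∣_∣ eq) size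
    apart′ : ∀ {z z′} → Case z → Case z′ → z ≢ z′ → Apart (block′ z) (block′ z′)
    apart′ (inj₁ (refl , _)) (inj₁ (refl , _)) z≢z′ = ⊥-elim (z≢z′ refl)
    apart′ (inj₁ (_ , eq)) (inj₂ (z′∈X , eq′)) _ y∈ y∈′ =
      x∈p─q⇒x∉q R Q (proj₁ (proj₂ (props z′∈X)) (subst (_ ∈_) eq′ y∈′)) (subst (_ ∈_) eq y∈)
    apart′ (inj₂ (z∈X , eq)) (inj₁ (_ , eq′)) _ y∈ y∈′ =
      x∈p─q⇒x∉q R Q (proj₁ (proj₂ (props z∈X)) (subst (_ ∈_) eq y∈)) (subst (_ ∈_) eq′ y∈′)
    apart′ (inj₂ (z∈X , eq)) (inj₂ (z′∈X , eq′)) z≢z′ y∈ y∈′ =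
      apart z∈X z′∈X z≢z′ (subst (_ ∈_) eq y∈) (subst (_ ∈_) eq′ y∈′)

layout : ∀ n w p → suc w * p ≤ n → Layout n (suc w) p
layout n w p wp≤n with subset-of-size (⊤ {n}) (suc w * p) (subst (suc w * p ≤_) (sym (∣⊤∣≡n n)) wp≤n)
... | R , R⊆⊤ , ∣R∣ with blocks w p R ∣R∣
...   | X , block , ∣X∣ , props , apart = record
  { X           = X
  ; Y           = ⊤ ─ R
  ; block       = block
  ; x∈block     = λ x∈ → proj₁ (props x∈)
  ; ∣block∣     = λ x∈ → proj₂ (proj₂ (props x∈))
  ; block⊥Y     = λ x∈ y∈ y∈Y → x∈p─q⇒x∉q ⊤ R y∈Y (proj₁ (proj₂ (props x∈)) y∈)
  ; block⊥block = apart
  ; ∣X∣         = ∣X∣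
  ; ∣Y∣         = trans (cong (∣ ⊤ ─ R ∣ +_) (sym ∣R∣)) (trans (∣p─q∣+∣q∣≡∣p∣ R⊆⊤) (∣⊤∣≡n n))
  }

∈-⋃⁻ : ∀ (M : List (Subset n)) {x} → x ∈ ⋃ M → Σ (Subset n) λ F → F ∈ˡ M × x ∈ F
∈-⋃⁻ []      x∈ = ⊥-elim (∉⊥ x∈)
∈-⋃⁻ (F ∷ M) x∈ with x∈p∪q⁻ F (⋃ M) x∈
... | inj₁ x∈F = F , here refl , x∈F
... | inj₂ x∈M with G , G∈ , x∈G ← ∈-⋃⁻ M x∈M = G , there G∈ , x∈G

∈-⋃⁺ : ∀ {M : List (Subset n)} {F x} → F ∈ˡ M → x ∈ F → x ∈ ⋃ M
∈-⋃⁺ {M = F ∷ M} (here refl) x∈ = p⊆p∪q (⋃ M) x∈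
∈-⋃⁺ {M = G ∷ M} (there F∈)  x∈ = q⊆p∪q G (⋃ M) (∈-⋃⁺ F∈ x∈)

module _ {n w p : ℕ} (lay : Layout n w p) where
  open Layout lay

  ∣⋃-blocks∣ : (xs : List (Fin n)) → Unique xs → (∀ {x} → x ∈ˡ xs → x ∈ X) → ∣ ⋃
    (map block xs) ∣ ≡ w * length xs
  ∣⋃-blocks∣ []       _                    xs⊆X = trans (∣⊥∣≡0 n) (sym (*-zeroʳ w))
  ∣⋃-blocks∣ (x ∷ xs) (x≢xs AllPairs.∷ uniq) xs⊆X = trans (∣p∪q∣≡∣p∣+∣q∣ apart)
    (trans (cong₂ _+_ (∣block∣ (xs⊆X (here refl))) (∣⋃-blocks∣ xs uniq (λ x∈ → xs⊆X (there x∈)))) (sym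
      (*-suc w (length xs))))
    where
    apart : Apart (block x) (⋃ (map block xs))
    apart y∈ y∈⋃ with F , F∈ , y∈F ← ∈-⋃⁻ (map block xs) y∈⋃ with x′ , x′∈ , refl ← ∈-map⁻ block F∈ =
      block⊥block (xs⊆X (here refl)) (xs⊆X (there x′∈)) (All.lookup x≢xs x′∈) y∈ y∈F

-- Assembling the phases

-- The first two terms of the binomial expansion of `(k + 1) ^ (m + 1)`.
bernoulli : ∀ k m → k ^ suc m + suc m * k ^ m ≤ suc k ^ suc m
bernoulli k zero    = ≤-reflexive (base k)
  where
  base : ∀ k → k * 1 + 1 * 1 ≡ suc k * 1
  base k = solve (k ∷ [])
bernoulli k (suc m) = begin
  k * (k * k ^ m) + suc (suc m) * (k * k ^ m)                         ≤⟨ m≤m+n _ (suc m * k ^ m) ⟩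
  k * (k * k ^ m) + suc (suc m) * (k * k ^ m) + suc m * k ^ m         ≡⟨ expand k m (k ^ m) ⟩
  suc k * (k * k ^ m + suc m * k ^ m)                                 ≤⟨ *-monoʳ-≤ (suc k) (bernoulli k m) ⟩
  suc k * suc k ^ suc m                                               ∎
  where
  open ≤-Reasoning
  expand : ∀ k m p → k * (k * p) + suc (suc m) * (k * p) + suc m * p ≡ suc k * (k * p + suc m * p)
  expand k m p = solve (k ∷ m ∷ p ∷ [])

halving : ∀ k → 2 * k ^ suc k ≤ suc k ^ suc k
halving k = ≤-trans (≤-trans (≤-reflexive (cong (k ^ suc k +_) (+-identityʳ _)))
  (+-monoʳ-≤ (k ^ suc k) (*-monoˡ-≤ (k ^ k) (n≤1+n k)))) (bernoulli k k)

^-distribʳ-* : ∀ m a b → (a * b) ^ m ≡ a ^ m * b ^ m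
^-distribʳ-* zero    a b = refl
^-distribʳ-* (suc m) a b = trans (cong (a * b *_) (^-distribʳ-* m a b)) (rearrange a b (a ^ m) (b ^ m))
  where
  rearrange : ∀ a b x y → a * b * (x * y) ≡ a * x * (b * y)
  rearrange a b x y = solve (a ∷ b ∷ x ∷ y ∷ [])

-- Every `suc k` rounds halve the potential, by `halving`, so the `suc k * (n * 4)` rounds of one
-- phase divide it by the fourth power of `2 ^ n`.
decay : ∀ k n → 2 ^ n * (2 ^ n * (2 ^ n * 2 ^ n)) * k ^ (suc k * (n * 4)) ≤ suc k ^ (suc k * (n * 4))
decay k n = begin
  2 ^ n * (2 ^ n * (2 ^ n * 2 ^ n)) * k ^ (suc k * (n * 4))
    ≡⟨ cong₂ _*_ (trans (cong (λ x → 2 ^ n * (2 ^ n * (2 ^ n * x))) (sym (*-identityʳ _)))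
      (^-*-assoc 2 n 4)) (sym (^-*-assoc k (suc k) (n * 4))) ⟩
  2 ^ (n * 4) * (k ^ suc k) ^ (n * 4)     ≡⟨ ^-distribʳ-* (n * 4) 2 (k ^ suc k) ⟨
  (2 * k ^ suc k) ^ (n * 4)               ≤⟨ ^-monoˡ-≤ (n * 4) (halving k) ⟩
  (suc k ^ suc k) ^ (n * 4)               ≡⟨ ^-*-assoc (suc k) (suc k) (n * 4) ⟩
  suc k ^ (suc k * (n * 4))               ∎
  where open ≤-Reasoning

-- ∣X∣ = p forces ∣Y∣ = p + s²d, so the second phase needs about sd successful rounds: enough
-- to absorb the at most sd vertices outside the core, and few enough for p-large to keep most
-- of Y removable throughout.
module Construction {n r t : ℕ} (sampling : Sampling n r) {d : ℕ} (0<d : 0 < d) {p : ℕ}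
                    (size : (3 + t) * (p + (3 + t) * d) ≡ n)
                    (p-large : (6 + 3 * ((3 + t) * (3 + t))) * d ≤ p) (lay : Layout n (2 + t) p)
                    (Y₁ : Subset n) (Y₁⊆Y : Y₁ ⊆ Layout.Y lay) (∣Y₁∣ : ∣ Y₁ ∣ ≡ (3 + 2 * ((3 + t) *
                      (3 + t))) * d) where

  private
    s : ℕ
    s = 3 + t

  open Layout lay

  private
    X⊥Y : Apart X Y
    X⊥Y x∈X = block⊥Y x∈X (x∈block x∈X)

    ∣hyperedge∣ : ∀ {x y} → x ∈ X → y ∈ Y → ∣ block x ∪ ⁅ y ⁆ ∣ ≡ s
    ∣hyperedge∣ {y = y} x∈X y∈Y = trans (∣p∪q∣≡∣p∣+∣q∣ (λ z∈x z∈y → block⊥Y x∈X z∈x (⁅x⁆⊆p y∈Y z∈y)))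
      (trans (cong₂ _+_ (∣block∣ x∈X) (∣⁅x⁆∣≡1 y)) (+-comm (2 + t) 1))

    ∣Y∣≡ : ∣ Y ∣ ≡ p + s * (s * d)
    ∣Y∣≡ = +-cancelʳ-≡ ((2 + t) * p) _ _ (trans ∣Y∣ (trans (sym size) (expand t p d)))
      where
      expand : ∀ t p d → (3 + t) * (p + (3 + t) * d) ≡ p + (3 + t) * ((3 + t) * d) + (2 + t) * p
      expand t p d = solve (t ∷ p ∷ d ∷ [])

    6d≤p : 6 * d ≤ p
    6d≤p = ≤-trans (*-monoˡ-≤ d (m≤m+n 6 (3 * (s * s)))) p-large

    6d≤X : 6 * d ≤ ∣ X ∣
    6d≤X = subst (6 * d ≤_) (sym ∣X∣) 6d≤p

    6d≤Y : 6 * d ≤ ∣ Y ∣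
    6d≤Y = ≤-trans 6d≤p (≤-trans (m≤m+n p _) (≤-reflexive (sym ∣Y∣≡)))

    y₁ : ℕ
    y₁ = (3 + 2 * (s * s)) * d

    Y₂ : Subset n
    Y₂ = Y ─ Y₁

    Y₁⊥Y₂ : Apart Y₁ Y₂
    Y₁⊥Y₂ x∈Y₁ x∈Y₂ = x∈p─q⇒x∉q Y Y₁ x∈Y₂ x∈Y₁

    ∣Y₂∣ : ∣ Y₂ ∣ + y₁ ≡ ∣ Y ∣
    ∣Y₂∣ = trans (cong (∣ Y₂ ∣ +_) (sym ∣Y₁∣)) (∣p─q∣+∣q∣≡∣p∣ Y₁⊆Y)

  module Phase₁ = Exposure {s = s} sampling X Y X⊥Y block x∈block ∣hyperedge∣ d 0<d

  module Phase₂ {H : List (Subset n)} (exposed : Phase₁.Exposed H) 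
                (joined : Joined (Adj (proj₁ exposed)) d X Y) (core₀ : Core (Adj
                  (proj₁ exposed)) d X Y) where

    private
      G = proj₁ exposed

    open Core core₀
    open Completion {t = t} sampling
      (adj? G) 0<d joined 6d≤X 6d≤Y core₀ block block⊥Y block⊥block ∣block∣ Y₁ Y₂ Y₁⊥Y₂ public

    private
      α β : ℕ
      α = ∣ X ─ A ∣
      β = ∣ Y ─ B ∣

      A+α : ∣ A ∣ + α ≡ p
      A+α = trans (+-comm (∣ A ∣) α) (trans (∣p─q∣+∣q∣≡∣p∣ A⊆X) ∣X∣)

      U Z : Subset n
      U = ⋃ (map block (elems A))
      Z = ⊤ ─ (B ∪ U)

      block⊆U : ∀ {x} → x ∈ A → block x ⊆ U
      block⊆U x∈A = ∈-⋃⁺ (∈-map⁺ block (∈-elems⁺ x∈A))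

      ∣U∣ : ∣ U ∣ ≡ (2 + t) * ∣ A ∣
      ∣U∣ = trans (∣⋃-blocks∣ lay (elems A) (elems-unique A) (λ x∈ → A⊆X (∈-elems⁻ A x∈))) (cong
        ((2 + t) *_) (length-elems A))

      B⊥U : Apart B U
      B⊥U y∈B y∈U with F , F∈ , y∈F ← ∈-⋃⁻ (map block (elems A)) y∈U with x , x∈ , refl ← ∈-map⁻ block F∈ =
        block⊥Y (A⊆X (∈-elems⁻ A x∈)) y∈F (B⊆Y y∈B)

      ∣Z∣ : ∣ Z ∣ + (∣ B ∣ + (2 + t) * ∣ A ∣) ≡ s * (p + s * d)
      ∣Z∣ = trans (cong (∣ Z ∣ +_) (sym (trans (∣p∪q∣≡∣p∣+∣q∣ B⊥U) (cong (∣ B ∣ +_) ∣U∣))))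
        (trans (∣p─q∣+∣q∣≡∣p∣ {p = ⊤} {B ∪ U} ⊆⊤) (trans (∣⊤∣≡n n) (sym size)))

      K : ℕ
      -- A perfect matching has `n / s = p + s * d` hyperedges, of which the core contributes
      -- `∣ A ∣ = p - α`.
      K = s * d + α

      balance : ∣ B ∣ + ∣ Z ∣ ≡ ∣ A ∣ + s * K
      balance = +-cancelʳ-≡ ((2 + t) * ∣ A ∣) _ _ (trans (rearrange (∣ B ∣) (∣ Z ∣) ((2 + t) * ∣ A ∣))
        (trans ∣Z∣ (trans (cong (λ p → s * (p + s * d)) (sym A+α)) (expand t (∣ A ∣) α d))))
        where
        rearrange : ∀ b z u → b + z + u ≡ z + (b + u)
        rearrange b z u = solve (b ∷ z ∷ u ∷ [])
        expand : ∀ t a α d → (3 + t) * (a + α + (3 + t) * d) ≡ a + (3 + t) * ((3 + t) * d + α) + (2 + t) * a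
        expand t a α d = solve (t ∷ a ∷ α ∷ d ∷ [])

      -- The uncovered vertices are the blocks of the at most `d` vertices pruned from `X` and the
      -- at most `d` vertices pruned from `Y`, at most `(2 + t) * d + d = s * d` in all.
      Z≤K : ∣ Z ∣ ≤ K
      Z≤K = arith t (∣ A ∣) (∣ B ∣) (∣ Z ∣) α β d p (∣ Y ∣) (≤-reflexive balance)
        (≤-reflexive (trans (sym (∣p─q∣+∣q∣≡∣p∣ B⊆Y)) (+-comm β (∣ B ∣)))) (≤-reflexive (sym ∣Y∣≡))
          (≤-reflexive A+α)
        (scale (2 + t) X─A≤d) Y─B≤d
        where
        arith : ∀ t a b z α β d p y → b + z ≤ a + (3 + t) * ((3 + t) * d + α) → y ≤ b + β → p + (3 + t) *
          ((3 + t) * d) ≤ y →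
                a + α ≤ p → (2 + t) * α ≤ (2 + t) * d → β ≤ d → z ≤ (3 + t) * d + α
        arith t a b z α β d p y h₁ h₂ h₃ h₄ h₅ h₆ = linear α
          (+-mono-≤ h₁ (+-mono-≤ h₂ (+-mono-≤ h₃ (+-mono-≤ h₄ (+-mono-≤ h₅ h₆)))))
          (solve (t ∷ a ∷ b ∷ z ∷ α ∷ β ∷ d ∷ p ∷ y ∷ []))

      A≤B : ∣ A ∣ ≤ ∣ B ∣
      A≤B = arith t (∣ A ∣) (∣ B ∣) (∣ Z ∣) K (≤-reflexive (sym balance)) Z≤K
        where
        arith : ∀ t a b z k → a + (3 + t) * k ≤ b + z → z ≤ k → a ≤ b
        arith t a b z k h₁ h₂ = linear ((2 + t) * k) (+-mono-≤ h₁ h₂) (solve (t ∷ a ∷ b ∷ z ∷ k ∷ []))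

      covered : ∣ ⊥ {n} ∣ + s * (K + ∣ A ∣) ≡ n
      covered = trans (cong (_+ s * (K + ∣ A ∣)) (∣⊥∣≡0 n)) (trans (trans (rearrange s (s * d) α (∣ A ∣))
        (cong (λ p → s * (p + s * d)) A+α)) size)
        where
        rearrange : ∀ s q α a → s * (q + α + a) ≡ s * (a + α + q)
        rearrange s q α a = solve (s ∷ q ∷ α ∷ a ∷ [])

    K≤n : K ≤ n
    K≤n = ≤-trans (≤-trans (m≤m+n K (∣ A ∣)) (m≤n*m (K + ∣ A ∣) s)) (≤-trans (m≤n+m _ (∣ ⊥ {n} ∣))
      (≤-reflexive covered))

    -- `T` misses at most `2 * (∣ Y ∣ - ∣ A ∣)` vertices of `Y`, hence at most
    -- `(2 + 2 * (s * s)) * d`. The set `Y₁` has `d` more than that by its choice, and `p-large`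
    -- makes `Y₂` at least as large as `Y₁`.
    rich : ∀ {T} → T ⊆ B → 2 * ∣ A ∣ ≤ ∣ T ∣ + ∣ B ∣ → d ≤ ∣ T ∩ Y₁ ∣ × d ≤ ∣ T ∩ Y₂ ∣
    rich {T} T⊆B 2A≤T+B =
      arith₁ t (∣ A ∣) (∣ B ∣) (∣ T ∣) (∣ T ∩ Y₁ ∣) (∣ Y ∣) (∣ Y₂ ∣) α d p 2A≤T+B (p⊆q⇒∣p∣≤∣q∣ B⊆Y) T≤₁
        (≤-reflexive ∣Y₂∣) (≤-reflexive ∣Y∣≡) (≤-reflexive (sym A+α)) X─A≤d ,
      arith₂ t (∣ A ∣) (∣ B ∣) (∣ T ∣) (∣ T ∩ Y₂ ∣) (∣ Y ∣) α d p 2A≤T+B (p⊆q⇒∣p∣≤∣q∣ B⊆Y) T≤₂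
        (≤-reflexive ∣Y∣≡) (≤-reflexive (sym A+α)) X─A≤d p-large
      where
      T≤₁ : ∣ T ∣ ≤ ∣ T ∩ Y₁ ∣ + ∣ Y₂ ∣
      T≤₁ = ≤-trans (p⊆q⇒∣p∣≤∣q∣ sub) (∣p∪q∣≤∣p∣+∣q∣ (T ∩ Y₁) Y₂)
        where
        sub : T ⊆ T ∩ Y₁ ∪ Y₂
        sub {x} x∈T with x ∈? Y₁
        ... | yes x∈Y₁ = x∈p∪q⁺ (inj₁ (x∈p∩q⁺ (x∈T , x∈Y₁)))
        ... | no  x∉Y₁ = x∈p∪q⁺ (inj₂ (x∈p∧x∉q⇒x∈p─q (B⊆Y (T⊆B x∈T)) x∉Y₁))
      T≤₂ : ∣ T ∣ ≤ ∣ T ∩ Y₂ ∣ + y₁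
      T≤₂ = ≤-trans (p⊆q⇒∣p∣≤∣q∣ sub) (≤-trans (∣p∪q∣≤∣p∣+∣q∣ (T ∩ Y₂) Y₁) (≤-reflexive (cong
        (∣ T ∩ Y₂ ∣ +_) ∣Y₁∣)))
        where
        sub : T ⊆ T ∩ Y₂ ∪ Y₁
        sub {x} x∈T with x ∈? Y₁
        ... | yes x∈Y₁ = x∈p∪q⁺ (inj₂ x∈Y₁)
        ... | no  x∉Y₁ = x∈p∪q⁺ (inj₁ (x∈p∩q⁺ (x∈T , x∈p∧x∉q⇒x∈p─q (B⊆Y (T⊆B x∈T)) x∉Y₁)))
      arith₁ : ∀ t a b τ τ₁ y y₂ α d p → 2 * a ≤ τ + b → b ≤ y → τ ≤ τ₁ + y₂ →
               y₂ + (3 + 2 * ((3 + t) * (3 + t))) * d ≤ y → y ≤ p + (3 + t) * ((3 + t) * d) → p ≤ a + α →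
                 α ≤ d → d ≤ τ₁
      arith₁ t a b τ τ₁ y y₂ α d p h₁ h₂ h₃ h₄ h₅ h₆ h₇ = linear 0
        (+-mono-≤ h₁ (+-mono-≤ h₂ (+-mono-≤ h₃ (+-mono-≤ h₄ (+-mono-≤ (scale 2 h₅) (+-mono-≤ (scale 2 h₆)
          (scale 2 h₇)))))))
        (solve (t ∷ a ∷ b ∷ τ ∷ τ₁ ∷ y ∷ y₂ ∷ α ∷ d ∷ p ∷ []))
      arith₂ : ∀ t a b τ τ₂ y α d p → 2 * a ≤ τ + b → b ≤ y → τ ≤ τ₂ + (3 + 2 * ((3 + t) * (3 + t))) * d →
               y ≤ p + (3 + t) * ((3 + t) * d) → p ≤ a + α → α ≤ d → (6 + 3 * ((3 + t) * (3 + t))) * d ≤ p →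
                 d ≤ τ₂
      arith₂ t a b τ τ₂ y α d p h₁ h₂ h₃ h₄ h₅ h₆ h₇ = linear 0
        (+-mono-≤ h₁ (+-mono-≤ h₂ (+-mono-≤ h₃ (+-mono-≤ h₄ (+-mono-≤ (scale 2 h₅) (+-mono-≤
          (scale 2 h₆) h₇))))))
        (solve (t ∷ a ∷ b ∷ τ ∷ τ₂ ∷ y ∷ α ∷ d ∷ p ∷ []))

    start : State rich H
    start = record
      { M        = []
      ; M⊆H      = All.[]
      ; disjoint = AllPairs.[]
      ; B′       = B
      ; Z        = Z
      ; K        = K
      ; B′⊆B     = λ x∈ → x∈
      ; hall     = core-hall (adj? G) joined 6d≤X 6d≤Y core₀ A≤B
      ; edges    = λ xy _ _ → proj₂ (proj₂ (All.lookup (proj₂ exposed) xy))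
      ; B′⊥M     = λ _ x∈⊥ → ∉⊥ x∈⊥
      ; Z⊥M      = λ _ x∈⊥ → ∉⊥ x∈⊥
      ; Z⊥B′     = λ x∈Z x∈B → x∈p─q⇒x∉q ⊤ (B ∪ U) x∈Z (p⊆p∪q U x∈B)
      ; block⊥M  = λ _ _ x∈⊥ → ∉⊥ x∈⊥
      ; block⊥Z  = λ x∈A z∈x z∈Z → x∈p─q⇒x∉q ⊤ (B ∪ U) z∈Z (q⊆p∪q B U (block⊆U x∈A z∈x))
      ; balance  = balance
      ; Z≤K      = Z≤K
      ; covered  = covered
      }

    potential-start : potential rich start ≤ 2 ^ n
    potential-start = ≤-trans (pot≤2^ K) (^-monoʳ-≤ 2 K≤n)

  private
    P Ω : ℕ
    P = 2 ^ n
    Ω = length (offers n r)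

    0<n : 0 < n
    0<n = ≤-trans (≤-trans 0<d (≤-trans (≤-trans (m≤n*m d s) (m≤n+m (s * d) p)) (m≤n*m (p + s * d) s)))
      (≤-reflexive size)

    2≤P : 2 ≤ P
    2≤P = ^-monoʳ-≤ 2 0<n

  rounds : ℕ → ℕ
  rounds k = suc k * (n * 4)

  module _ {k : ℕ} (k-large : 2 * (n * n) ≤ suc k * (d * d)) where

    private
      ℓ κᵖ kᵖ : ℕ
      ℓ  = rounds k
      κᵖ = suc k ^ ℓ
      kᵖ = k ^ ℓ

      instance
        κᵖ-nonZero : NonZero κᵖ
        κᵖ-nonZero = m^n≢0 (suc k) ℓ
        P-nonZero : NonZero P
        P-nonZero = m^n≢0 2 n

    -- The initial potential is at most `P` and one phase divides it by the fourth power of `P`, so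
    -- the fraction of losing sequences is at most the inverse cube of `P`.
    settle₂ : ∀ {x V W φ} → φ ≤ P → κᵖ * (1 * x) ≤ kᵖ * 1 * W * φ + κᵖ * V * 0 → P * (P * P) * x ≤ W
    settle₂ {x} {V} {W} {φ} φ≤P le = *-cancelˡ-≤ κᵖ (begin
      κᵖ * (P * (P * P) * x)                      ≡⟨ rearrange₁ κᵖ P x ⟩
      P * (P * P) * (κᵖ * (1 * x))                ≤⟨ *-monoʳ-≤ (P * (P * P)) le ⟩
      P * (P * P) * (kᵖ * 1 * W * φ + κᵖ * V * 0) ≡⟨ rearrange₂ P kᵖ W φ (κᵖ * V) ⟩
      P * (P * P) * kᵖ * W * φ                    ≤⟨ *-monoʳ-≤ (P * (P * P) * kᵖ * W) φ≤P ⟩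
      P * (P * P) * kᵖ * W * P                    ≡⟨ rearrange₃ P kᵖ W ⟩
      P * (P * (P * P)) * kᵖ * W                  ≤⟨ *-monoˡ-≤ W (decay k n) ⟩
      κᵖ * W                                      ∎)
      where
      open ≤-Reasoning
      rearrange₁ : ∀ κ P x → κ * (P * (P * P) * x) ≡ P * (P * P) * (κ * (1 * x))
      rearrange₁ κ P x = solve (κ ∷ P ∷ x ∷ [])
      rearrange₂ : ∀ P k W φ V → P * (P * P) * (k * 1 * W * φ + V * 0) ≡ P * (P * P) * k * W * φ
      rearrange₂ P k W φ V = solve (P ∷ k ∷ W ∷ φ ∷ V ∷ [])
      rearrange₃ : ∀ P k W → P * (P * P) * k * W * P ≡ P * (P * (P * P)) * k * W
      rearrange₃ P k W = solve (P ∷ k ∷ W ∷ [])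

    -- Here the initial potential is at most `P * P`, so the first phase fails with probability at
    -- most the inverse square of `P`. Together with the inverse cube from the second phase this is
    -- at most `1 / P`.
    settle₁ : ∀ {x V V′ W φ} → φ ≤ P * P → V * V′ ≡ W →
              κᵖ * (P * (P * P) * x) ≤ kᵖ * (P * (P * P)) * W * φ + κᵖ * V * V′ → P * x ≤ W
    settle₁ {x} {V} {V′} {W} {φ} φ≤P² refl le = *-cancelˡ-≤ κᵖ (*-cancelˡ-≤ P (*-cancelˡ-≤ P (begin
      P * (P * (κᵖ * (P * x)))                          ≡⟨ rearrange₁ κᵖ P x ⟩
      κᵖ * (P * (P * P) * x)                            ≤⟨ le ⟩
      kᵖ * (P * (P * P)) * W * φ + κᵖ * V * V′          ≤⟨ +-monoˡ-≤ (κᵖ * V * V′) (*-monoʳ-≤ (kᵖ * (P *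
        (P * P)) * W) φ≤P²) ⟩
      kᵖ * (P * (P * P)) * W * (P * P) + κᵖ * V * V′    ≡⟨ rearrange₂ P kᵖ κᵖ V V′ ⟩
      P * (P * (P * P)) * kᵖ * (P * W) + κᵖ * (1 * W)   ≤⟨ +-mono-≤ (*-monoˡ-≤ (P * W) (decay k n))
        (*-monoʳ-≤ κᵖ (*-monoˡ-≤ W (≤-trans (n≤1+n 1) 2≤P))) ⟩
      κᵖ * (P * W) + κᵖ * (P * W)                       ≡⟨ rearrange₃ κᵖ P W ⟩
      2 * (P * (κᵖ * W))                                ≤⟨ *-monoˡ-≤ (P * (κᵖ * W)) 2≤P ⟩
      P * (P * (κᵖ * W))                                ∎)))
      where
      open ≤-Reasoning
      rearrange₁ : ∀ κ P x → P * (P * (κ * (P * x))) ≡ κ * (P * (P * P) * x)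
      rearrange₁ κ P x = solve (κ ∷ P ∷ x ∷ [])
      rearrange₂ : ∀ P k κ V V′ → k * (P * (P * P)) * (V * V′) * (P * P) + κ * V * V′ ≡ P * (P *
        (P * P)) * k * (P * (V * V′)) + κ * (1 * (V * V′))
      rearrange₂ P k κ V V′ = solve (P ∷ k ∷ κ ∷ V ∷ V′ ∷ [])
      rearrange₃ : ∀ κ P W → κ * (P * W) + κ * (P * W) ≡ 2 * (P * (κ * W))
      rearrange₃ κ P W = solve (κ ∷ P ∷ W ∷ [])

    game₂ : ∀ {H} (exposed : Phase₁.Exposed H) (joined : Joined (Adj (proj₁ exposed)) d X Y) →
            Core (Adj (proj₁ exposed)) d X Y →
            Σ (Game n r s (ℓ + 0) H) λ g → P * (P * P) * loss g ≤ Ω ^ (ℓ + 0)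
    game₂ {H} exposed joined core₀ = proj₁ play₂ , settle₂ potential-start (proj₂ play₂)
      where
      open Phase₂ exposed joined core₀
      play₂ : Σ (Game n r s (ℓ + 0) H) λ g →
              κᵖ * (1 * loss g) ≤ kᵖ * 1 * Ω ^ (ℓ + 0) * potential rich start + κᵖ * Ω ^ ℓ * 0
      play₂ = iterate {k = k} {St = State rich} {φ = potential rich}
        (step rich k-large) {L = 0} {w = 1} {b = 0}
        (λ st pot≡0 → won (finish rich st pot≡0) , ≤-refl) ℓ start

    game : Σ (Game n r s (ℓ + (ℓ + 0)) []) λ g → P * loss g ≤ Ω ^ (ℓ + (ℓ + 0))
    game = proj₁ play₁ , settle₁ (Phase₁.potential-start {[]}) (sym (^-distribˡ-+-* Ω ℓ (ℓ + 0)))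
      (proj₂ play₁)
      where
      play₁ : Σ (Game n r s (ℓ + (ℓ + 0)) []) λ g →
              κᵖ * (P * (P * P) * loss g) ≤ kᵖ * (P * (P * P)) * Ω ^ (ℓ + (ℓ + 0)) * Phase₁.potential
                (Phase₁.start {[]}) + κᵖ * Ω ^ ℓ * Ω ^ (ℓ + 0)
      play₁ = iterate {k = k} {St = Phase₁.Exposed} {φ = Phase₁.potential}
        (λ st _ → Phase₁.step (≤-trans (m≤n*m (n * n) 2) k-large) st)
        (λ st hit → let joined = Phase₁.potential≡0⇒joined st hit in
          game₂ st joined (core (adj? (proj₁ st)) joined 6d≤X 6d≤Y)) ℓ Phase₁.start

n<2^n : ∀ n → n < 2 ^ n
n<2^n zero    = z<s
n<2^n (suc n) = ≤-trans (+-mono-≤ (≤-trans (s≤s z≤n) (n<2^n n)) (n<2^n n))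
  (≤-reflexive (cong (2 ^ n +_) (sym (+-identityʳ _))))

-- Constants and the resulting strategy

module Strategies (t r : ℕ) (sampling : ∀ n → Sampling n r) where

  private
    s κ₀ e k : ℕ
    s  = 3 + t
    -- With `M = n / s` and `d` the integer part of `M / κ₀`, subtracting `s * d` from `M` leaves a
    -- `p` satisfying `p-large`. Rounding down costs at most a factor of two, so `n ≤ e * d`, and
    -- `k` is chosen to give `2 * (n * n) ≤ suc k * (d * d)`.
    κ₀ = 6 + 3 * (s * s) + s
    e  = 2 * s * κ₀
    k  = 2 * (e * e)

  rate threshold : ℕ
  -- Two phases of `suc k * (n * 4)` rounds each.
  rate      = suc k * 8
  threshold = s * κ₀

  private
    rate* : ∀ n → suc k * (n * 4) + (suc k * (n * 4) + 0) ≡ rate * n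
    rate* n = expand (suc k) n
      where
      expand : ∀ κ n → κ * (n * 4) + (κ * (n * 4) + 0) ≡ κ * 8 * n
      expand κ n = solve (κ ∷ n ∷ [])

    Ω : ℕ → ℕ
    Ω n = length (offers n r)

    Good : ℕ → Set
    Good n = Σ (Game n r s (rate * n) []) λ g → 2 ^ n * loss g ≤ Ω n ^ (rate * n)

    good : ∀ n → s ∣ n → threshold ≤ n → Good n
    good n (divides M n≡Ms) κ₀s≤n = subst (λ L → Σ (Game n r s L []) λ g → 2 ^ n * loss g ≤ Ω n ^ L)
      (rate* n)
      (game (subset-of-size (Layout.Y lay) y₁ y₁≤Y))
      where
      d p y₁ : ℕ
      d  = M / κ₀
      p  = M ∸ s * d
      y₁ = (3 + 2 * (s * s)) * d
      κ₀≤M : κ₀ ≤ M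
      κ₀≤M = *-cancelˡ-≤ s (≤-trans κ₀s≤n (≤-reflexive (trans n≡Ms (*-comm M s))))
      0<d : 0 < d
      0<d = m≥n⇒m/n>0 κ₀≤M
      κ₀d≤M : (6 + 3 * (s * s)) * d + s * d ≤ M
      κ₀d≤M = ≤-trans (≤-reflexive (trans (sym (*-distribʳ-+ d (6 + 3 * (s * s)) s)) (*-comm κ₀ d)))
        (m/n*n≤m M κ₀)
      p-large : (6 + 3 * (s * s)) * d ≤ p
      p-large = m+n≤o⇒m≤o∸n _ κ₀d≤M
      size : s * (p + s * d) ≡ n
      size = trans (cong (s *_) (m∸n+n≡m (≤-trans (m≤n+m (s * d) ((6 + 3 * (s * s)) * d)) κ₀d≤M))) (trans
        (*-comm s M) (sym n≡Ms))
      n≤ed : n ≤ e * d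
      n≤ed = begin
        n                       ≡⟨ n≡Ms ⟩
        M * s                   ≡⟨ cong (_* s) (m≡m%n+[m/n]*n M κ₀) ⟩
        (M % κ₀ + d * κ₀) * s   ≤⟨ *-monoˡ-≤ s (+-monoˡ-≤ (d * κ₀) (≤-trans (<⇒≤ (m%n<n M κ₀))
          (m≤n*m κ₀ d))) ⟩
        (d * κ₀ + d * κ₀) * s   ≡⟨ rearrange d κ₀ s ⟩
        e * d                   ∎
        where
        open ≤-Reasoning
        instance _ = >-nonZero 0<d
        rearrange : ∀ d κ s → (d * κ + d * κ) * s ≡ 2 * s * κ * d
        rearrange d κ s = solve (d ∷ κ ∷ s ∷ [])
      k-large : 2 * (n * n) ≤ suc k * (d * d)
      k-large = begin
        2 * (n * n)              ≤⟨ *-monoʳ-≤ 2 (*-mono-≤ n≤ed n≤ed) ⟩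
        2 * (e * d * (e * d))    ≡⟨ rearrange e d ⟩
        2 * (e * e) * (d * d)    ≤⟨ *-monoˡ-≤ (d * d) (n≤1+n k) ⟩
        suc k * (d * d)          ∎
        where
        open ≤-Reasoning
        rearrange : ∀ e d → 2 * (e * d * (e * d)) ≡ 2 * (e * e) * (d * d)
        rearrange e d = solve (e ∷ d ∷ [])
      lay : Layout n (2 + t) p
      lay = layout n (1 + t) p (≤-trans (*-mono-≤ (n≤1+n (2 + t)) (m≤m+n p (s * d))) (≤-reflexive size))
      y₁≤Y : y₁ ≤ ∣ Layout.Y lay ∣
      y₁≤Y = ≤-trans (*-monoˡ-≤ d (+-mono-≤ (m≤m+n 3 3) (*-monoˡ-≤ (s * s) (n≤1+n 2))))
        (≤-trans p-large (+-cancelʳ-≤ ((2 + t) * p) p _ (≤-trans (≤-trans (*-monoʳ-≤ s (m≤m+n p (s * d)))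
          (≤-reflexive size)) (≤-reflexive (sym (Layout.∣Y∣ lay))))))
      game : Σ (Subset n) (λ Y₁ → Y₁ ⊆ Layout.Y lay × ∣ Y₁ ∣ ≡ y₁) →
             Σ (Game n r s (suc k * (n * 4) + (suc k * (n * 4) + 0)) []) λ g → 2 ^ n * loss g ≤ Ω n ^
               (suc k * (n * 4) + (suc k * (n * 4) + 0))
      game (Y₁ , Y₁⊆Y , ∣Y₁∣) = Construction.game {t = t}
        (sampling n) 0<d size p-large lay Y₁ Y₁⊆Y ∣Y₁∣ {k} k-large

  plan : ∀ n → Σ (Game n r s (rate * n) []) λ g → s ∣ n → threshold ≤ n → 2 ^ n * loss g ≤ Ω n ^ (rate * n)
  plan n with s ∣? n | threshold ≤? n
  ... | yes s∣n | yes n≥ = let (g , le) = good n s∣n n≥ in g , λ _ _ → le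
  -- Nothing is claimed for these `n` or for those below the threshold, so the game may be given up.
  ... | no  s∤n | _      = losing _ , λ s∣n _ → ⊥-elim (s∤n s∣n)
  ... | yes _   | no n≱  = losing _ , λ _ n≥ → ⊥-elim (n≱ n≥)

  strategy : Strategy s r
  strategy n = follow (proj₁ (plan n))

  -- The losing fraction is at most `1 / 2 ^ n`, which is below `1 / (1 + m)` as soon as `n` is at
  -- least `1 + m`. The winning offer sequences are the good ones.
  succeeds : (m n : ℕ) → suc m ⊔ threshold ≤ n → s ∣ n →
             Σ (List (Vec (Offer n r) (rate * n))) λ good →
               Unique good
               × All (λ ω → HasPerfectMatching (hypergraph strategy n (toList ω))) good
               × m * ((n C r) ^ (rate * n)) ≤ suc m * length good
  succeeds m n N≤n s∣n = wins g , wins-unique g ,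
    All.tabulate (λ {ω} ω∈ → follow-wins strategy g [] (λ _ _ → refl) (hypergraph strategy n (toList ω))
      (λ ()) ω∈ (λ E∈ → E∈)) ,
    subst (λ x → m * x ^ (rate * n) ≤ suc m * length (wins g)) (length-offers n r)
      (arith m (Ω n ^ (rate * n)) (length (wins g)) (loss g) (≤-reflexive (sym (length-wins g))) loss-small)
    where
    g = proj₁ (plan n)
    loss-small : suc m * loss g ≤ Ω n ^ (rate * n)
    loss-small = ≤-trans (*-monoˡ-≤ (loss g) (≤-trans (m⊔n≤o⇒m≤o (suc m) threshold N≤n) (<⇒≤ (n<2^n n))))
      (proj₂ (plan n) s∣n (m⊔n≤o⇒n≤o (suc m) threshold N≤n))
    arith : ∀ m T w l → T ≤ w + l → suc m * l ≤ T → m * T ≤ suc m * w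
    arith m T w l h₁ h₂ = linear 0 (+-mono-≤ (scale (suc m) h₁) h₂) (solve (m ∷ T ∷ w ∷ l ∷ []))

theorem2 : (s r : ℕ) → 3 ≤ s → (r ≡ 1 ⊎ r ≡ 2) →
    Σ ℕ λ c → Σ (Strategy s r) λ σ →
    (m : ℕ) → Σ ℕ λ N → (n : ℕ) → N ≤ n → s ∣ n →
    Σ (List (Vec (Offer n r) (c * n))) λ good →
    Unique good
    × All (λ ω → HasPerfectMatching (hypergraph σ n (toList ω))) good
    × m * ((n C r) ^ (c * n)) ≤ suc m * length good
theorem2 (suc (suc (suc t))) r _ r∈ = rate , strategy , λ m → suc m ⊔ threshold , succeeds m
  where
  sampling : ∀ n → Sampling n r
  sampling n = [ (λ { refl → sampling₁ n }) , (λ { refl → sampling₂ n }) ]′ r∈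
  open Strategies t r sampling
theorem2 (suc (suc zero)) r (s≤s (s≤s ())) _
theorem2 (suc zero)       r (s≤s ())       _
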